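{- Let $\mathcal{A}$ be a monounary algebra. Then the following are equivalent: (1) $\mathcal{A}$ is partially homogeneous; (2) $\mathcal{A}$ is partially $1$-homogeneous and partially $2$-homogeneous; (3) $\mathcal{A}^*$ is ultrahomogeneous; (4) $\mathcal{A}^*$ is $2$-ultrahomogeneous; (5) $\mathcal{A}$ is isomorphic to one of: (i) $\alpha\cdot\mathcal{Z}_1+\beta\cdot\mathcal{Z}_2$ for some cardinals $\alpha,\beta$; (ii) $\alpha\cdot\mathcal{Z}_1+\beta\cdot\mathcal{Z}_3$ for some cardinals $\alpha,\beta$; (iii) $\alpha\cdot\mathcal{Z}_1+\mathcal{Z}_4$ for some cardinal $\alpha$; (iv) $\alpha\cdot\mathcal{A}[1;1]$ for some cardinal $\alpha$; (v) $\mathcal{A}[1;\alpha]$ for some cardinal $\alpha$. In particular, if $\mathcal{A}^*$ is ultrahomogeneous then $\mathcal{A}$ is ultrahomogeneous.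
   Context: A monounary algebra is a pair $\mathcal{A}=(A;\theta)$ where $A$ is a nonempty set (of arbitrary cardinality) and $\theta\colon A\to A$. Each nonempty $B\subseteq A$ gives a partial subalgebra $\mathcal{B}=(B;\theta_B)$ with $\mathrm{dom}(\theta_B)=\{b\in B:\theta(b)\in B\}$ and $\theta_B(b)=\theta(b)$ on its domain; it is a subalgebra if $\mathrm{dom}(\theta_B)=B$. An isomorphism between partial monounary algebras $(B;\theta)$ and $(B';\theta')$ is a bijection $\phi\colon B\to B'$ such that $x\in\mathrm{dom}(\theta)$ if and only if $\phi(x)\in\mathrm{dom}(\theta')$, and then $\phi(\theta(x))=\theta'(\phi(x))$. An automorphism of $\mathcal{A}$ is an isomorphism of $\mathcal{A}$ with itself. $\mathcal{A}$ is partially $n$-homogeneous if every isomorphism between partial subalgebras of $\mathcal{A}$ of size $n$ extends to an automorphism of $\mathcal{A}$; it is partially homogeneous if this holds for every $n\geq 1$. The relational form of $\mathcal{A}$ is the digraph $\mathcal{A}^*=(A;R_\theta)$ with $(x,y)\in R_\theta$ iff $\theta(x)=y$ (loops allowed). A structure $\mathcal{M}$ is $n$-ultrahomogeneous if every isomorphism between substructures generated by $n$ elements (not necessarily distinct) extends to an automorphism of $\mathcal{M}$, and ultrahomogeneous if it is $n$-ultrahomogeneous for every $n\geq 1$. (For $\mathcal{A}^*$, substructures are induced subdigraphs; for $\mathcal{A}$, they are subalgebras.) $\mathcal{Z}_n$ is the $n$-cycle $(\{0,\dots,n-1\};\, i\mapsto i+1 \bmod n)$. $+$ is disjoint union and $\alpha\cdot\mathcal{C}$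 is the disjoint union of $\alpha$ copies of $\mathcal{C}$ (cardinals may be $0$, giving an empty summand). $\mathcal{A}[1;\alpha]$ is the monounary algebra consisting of a single fixed point $c$ of $\theta$ together with $\alpha$ further elements, all mapped to $c$ by $\theta$ (these having no preimages). -}

module Defs where

open import Data.Fin.Base using (Fin; toℕ)
open import Data.Irrelevant using ([_])
open import Data.Maybe.Base using (Maybe; nothing)
open import Data.Nat.Base using (ℕ; suc; NonZero; _≥_)
open import Data.Nat.DivMod using (_mod_)
open import Data.Product.Base using (Σ-syntax; ∃-syntax; _×_; _,_)
open import Data.Refinement.Base as Refinement using (Refinement; value; _,_)
open import Data.Sum.Base as Sum using (_⊎_)
open import Data.Unit.Polymorphic.Base using (⊤)
open import Function.Bundles using (_⤖_; _⇔_; Bijection)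
open import Level using (Level; _⊔_; 0ℓ) renaming (suc to lsuc)
open import Relation.Binary.Core using (Rel)
open import Relation.Binary.PropositionalEquality.Core using (_≡_)
open import Relation.Unary using (Pred)

private
  variable
    a b : Level

-- The carrier may be empty here, so that a disjoint union of zero copies is
-- again of this type; nonemptiness is assumed separately where it is needed.

record MonounaryAlgebra (a : Level) : Set (lsuc a) where
  field
    Carrier : Set a
    θ       : Carrier → Carrier

record PartialMonounaryAlgebra (a : Level) : Set (lsuc a) where
  field
    Carrier : Set a
    Dom     : Pred Carrier a
    θ       : (x : Carrier) → .(Dom x) → Carrier

record _≅ₚ_ (𝓟 : PartialMonounaryAlgebra a) (𝓠 : PartialMonounaryAlgebra b) :
            Set (a ⊔ b) where
  private
    module P = PartialMonounaryAlgebra 𝓟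
    module Q = PartialMonounaryAlgebra 𝓠
  field
    bijection : P.Carrier ⤖ Q.Carrier
  open Bijection bijection public using (to)
  field
    dom⇔ : ∀ x → P.Dom x ⇔ Q.Dom (to x)
    homo : ∀ x .(p : P.Dom x) .(q : Q.Dom (to x)) → to (P.θ x p) ≡ Q.θ (to x) q

total : MonounaryAlgebra a → PartialMonounaryAlgebra a
total 𝓐 = record
  { Carrier = Carrier
  ; Dom     = λ _ → ⊤
  ; θ       = λ x _ → θ x
  } where open MonounaryAlgebra 𝓐

infix 4 _≅ₚ_ _≅_

_≅_ : MonounaryAlgebra a → MonounaryAlgebra b → Set (a ⊔ b)
𝓐 ≅ 𝓑 = total 𝓐 ≅ₚ total 𝓑

-- A subset B of A is a predicate, and its set of elements is Refinement A B:
-- membership proofs are irrelevant, so two elements of B are equal exactly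
-- when their values in A are equal.

Extends : {A : Set a} {B B′ : Pred A b} →
          (A → A) → (Refinement A B → Refinement A B′) → Set (a ⊔ b)
Extends ψ φ = ∀ x → ψ (value x) ≡ value (φ x)

module _ (𝓐 : MonounaryAlgebra a) where
  open MonounaryAlgebra 𝓐

  partialSubalgebra : Pred Carrier a → PartialMonounaryAlgebra a
  partialSubalgebra B = record
    { Carrier = Refinement Carrier B
    ; Dom     = λ x → B (θ (value x))
    ; θ       = λ x p → θ (value x) , [ p ]
    }

  PartiallyNHomogeneous : ℕ → Set (lsuc a)
  PartiallyNHomogeneous n =
    (B B′ : Pred Carrier a) →
    Fin n ⤖ Refinement Carrier B →
    Fin n ⤖ Refinement Carrier B′ →
    (φ : partialSubalgebra B ≅ₚ partialSubalgebra B′) →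
    Σ[ ψ ∈ 𝓐 ≅ 𝓐 ] Extends (_≅ₚ_.to ψ) (_≅ₚ_.to φ)

  PartiallyHomogeneous : Set (lsuc a)
  PartiallyHomogeneous = ∀ n → n ≥ 1 → PartiallyNHomogeneous n

  data Generated {n : ℕ} (xs : Fin n → Carrier) : Pred Carrier a where
    generator : ∀ i → Generated xs (xs i)
    closed    : ∀ {x} → Generated xs x → Generated xs (θ x)

  generatedSubalgebra : {n : ℕ} → (Fin n → Carrier) → MonounaryAlgebra a
  generatedSubalgebra xs = record
    { Carrier = Refinement Carrier (Generated xs)
    ; θ       = Refinement.map θ closed
    }

  NUltrahomogeneous : ℕ → Set a
  NUltrahomogeneous n =
    (xs ys : Fin n → Carrier) →
    (φ : generatedSubalgebra xs ≅ generatedSubalgebra ys) →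
    Σ[ ψ ∈ 𝓐 ≅ 𝓐 ] Extends (_≅ₚ_.to ψ) (_≅ₚ_.to φ)

  Ultrahomogeneous : Set a
  Ultrahomogeneous = ∀ n → n ≥ 1 → NUltrahomogeneous n

record Digraph (a : Level) : Set (lsuc a) where
  field
    Carrier : Set a
    R       : Rel Carrier a

record _≅ᵈ_ (𝓖 : Digraph a) (𝓗 : Digraph b) : Set (a ⊔ b) where
  private
    module G = Digraph 𝓖
    module H = Digraph 𝓗
  field
    bijection : G.Carrier ⤖ H.Carrier
  open Bijection bijection public using (to)
  field
    edge⇔ : ∀ x y → G.R x y ⇔ H.R (to x) (to y)

infix 4 _≅ᵈ_

module _ (𝓖 : Digraph a) where
  open Digraph 𝓖

  induced : Pred Carrier a → Digraph a
  induced B = record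
    { Carrier = Refinement Carrier B
    ; R       = λ x y → R (value x) (value y)
    }

  -- There are no operations to close under, so the substructure generated by
  -- a tuple is the subdigraph induced on the set of its entries.

  generatedSubdigraph : {n : ℕ} → (Fin n → Carrier) → Digraph a
  generatedSubdigraph xs = induced (λ z → ∃[ i ] xs i ≡ z)

  NUltrahomogeneousᵈ : ℕ → Set a
  NUltrahomogeneousᵈ n =
    (xs ys : Fin n → Carrier) →
    (φ : generatedSubdigraph xs ≅ᵈ generatedSubdigraph ys) →
    Σ[ ψ ∈ 𝓖 ≅ᵈ 𝓖 ] Extends (_≅ᵈ_.to ψ) (_≅ᵈ_.to φ)

  Ultrahomogeneousᵈ : Set a
  Ultrahomogeneousᵈ = ∀ n → n ≥ 1 → NUltrahomogeneousᵈ n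

infix 8 _*

_* : MonounaryAlgebra a → Digraph a
𝓐 * = record { Carrier = Carrier ; R = λ x y → θ x ≡ y }
  where open MonounaryAlgebra 𝓐

𝓩 : (n : ℕ) .{{_ : NonZero n}} → MonounaryAlgebra 0ℓ
𝓩 n = record { Carrier = Fin n ; θ = λ i → suc (toℕ i) mod n }

-- A cardinal is represented by a type of that cardinality.

infixl 6 _+_
infixr 7 _·_

_+_ : MonounaryAlgebra a → MonounaryAlgebra b → MonounaryAlgebra (a ⊔ b)
𝓐 + 𝓑 = record { Carrier = A.Carrier ⊎ B.Carrier ; θ = Sum.map A.θ B.θ }
  where
  module A = MonounaryAlgebra 𝓐
  module B = MonounaryAlgebra 𝓑

_·_ : Set a → MonounaryAlgebra b → MonounaryAlgebra (a ⊔ b)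
α · 𝓒 = record { Carrier = α × Carrier ; θ = λ (i , x) → i , θ x }
  where open MonounaryAlgebra 𝓒

-- The fixed point c is nothing, and the other elements are just i for i : α.

𝓐[1⨾_] : Set a → MonounaryAlgebra a
𝓐[1⨾ α ] = record { Carrier = Maybe α ; θ = λ _ → nothing }

{-# OPTIONS --safe #-}
module Submission where

-- Every isomorphism of finite partial subalgebras, or of finite induced subdigraphs, is
-- the same thing as a pair of tuples satisfying the same equations x = y and θ x = y, so
-- all the homogeneity conditions are compared with the one for tuples.  Homogeneity for
-- pairs makes all non-fixed points look alike.  If θ x is fixed for these, then either θ is
-- constant or every fixed point has a single further preimage; otherwise θ² or θ³ is the
-- identity, or else x and θ² x, being joined by no edge, can be exchanged or θ² x replaced
-- by any point outside the orbit of x, which forces a single 4-cycle.  Conversely, in each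
-- of these algebras a tuple is extended one point at a time by an automorphism that swaps
-- two orbits or rotates one cycle and fixes the points already treated.

open import Axiom.ExcludedMiddle using (ExcludedMiddle)
open import Axiom.Extensionality.Propositional using (Extensionality)
open import Data.Bool.Base using (Bool; true)
open import Data.Fin.Base using (Fin; zero; suc; toℕ)
open import Data.Fin.Properties as Fin using (toℕ-fromℕ<; toℕ-injective; toℕ<n; all?; any?)
open import Data.Irrelevant using ([_])
open import Data.Maybe.Base using (Maybe; nothing; just)
open import Data.Nat.Base as ℕ using (ℕ; zero; suc; nonZero; z≤n; s≤s; s<s; _<_)
open import Data.Nat.DivMod using (_mod_; _%_; _/_; m≡m%n+[m/n]*n; m%n<n)
open import Data.Nat.GeneralisedArithmetic using (fold; fold-+)
open import Data.Nat.Properties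
  using (+-comm; *-suc; <-cmp; m<n⇒0<n∸m; ≤-<-trans; m∸n≤m; m+[n∸m]≡n; <⇒≤)
open import Data.Product.Base using (_×_; Σ-syntax; ∃-syntax; _,_; proj₁; proj₂)
open import Data.Refinement.Base using (Refinement; value; _,_)
open import Data.Refinement.Properties using (value-injective)
open import Data.Sum.Base as Sum using (_⊎_; inj₁; inj₂)
open import Data.Unit.Base using (⊤)
open import Data.Vec.Functional using (Vector; _∷_; []; tail)
open import Function.Base using (_∘_)
open import Function.Bundles using (_⇔_; _⤖_; mk⇔; mk⤖; Equivalence; Bijection)
open import Function.Consequences.Propositional using (strictlySurjective⇒surjective)
open import Function.Construct.Composition using (_⤖-∘_; _⇔-∘_)
open import Function.Construct.Identity using (⤖-id; ⇔-id)
open import Function.Construct.Symmetry using (⇔-sym)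
open import Function.Definitions using (Injective; StrictlySurjective)
open import Level using (Level; 0ℓ; lift; _⊔_) renaming (suc to lsuc)
open import Relation.Binary.Definitions using (tri<; tri≈; tri>)
open import Relation.Binary.PropositionalEquality
open import Relation.Nullary.Decidable
  using (Dec; yes; no; does; recompute; decidable-stable; dec-true; does-⇔; from-yes)
open import Relation.Nullary.Negation using (¬_; contradiction)
open import Relation.Unary using (Pred)
open import Defs

open Equivalence using () renaming (to to fwd; from to bwd)
open _≅ₚ_ using (to)

private
  variable
    a b c : Level

-- Isomorphisms of monounary algebras and of their digraphs.

bijective : {A : Set a} {B : Set b} (f : A → B) →
            Injective _≡_ _≡_ f → StrictlySurjective _≡_ f → A ⤖ B
bijective f inj surj = mk⤖ {to = f} (inj , strictlySurjective⇒surjective surj)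

Homomorphic : (𝓐 : MonounaryAlgebra a) (𝓑 : MonounaryAlgebra b) →
              (MonounaryAlgebra.Carrier 𝓐 → MonounaryAlgebra.Carrier 𝓑) → Set (a ⊔ b)
Homomorphic 𝓐 𝓑 f = ∀ x → f (MonounaryAlgebra.θ 𝓐 x) ≡ MonounaryAlgebra.θ 𝓑 (f x)

module _ {𝓐 : MonounaryAlgebra a} {𝓑 : MonounaryAlgebra b} where
  private
    module A = MonounaryAlgebra 𝓐
    module B = MonounaryAlgebra 𝓑

  isomorphism : (f : A.Carrier ⤖ B.Carrier) →
                Homomorphic 𝓐 𝓑 (Bijection.to f) → 𝓐 ≅ 𝓑
  isomorphism f hom = record
    { bijection = f
    ; dom⇔      = λ _ → mk⇔ (λ _ → lift _) (λ _ → lift _)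
    ; homo      = λ x _ _ → hom x
    }

  ≅-homo : (ψ : 𝓐 ≅ 𝓑) → Homomorphic 𝓐 𝓑 (to ψ)
  ≅-homo ψ x = _≅ₚ_.homo ψ x (lift _) (lift _)

  ≅-injective : (ψ : 𝓐 ≅ 𝓑) → Injective _≡_ _≡_ (to ψ)
  ≅-injective ψ = Bijection.injective (_≅ₚ_.bijection ψ)

  ≅-surjective : (ψ : 𝓐 ≅ 𝓑) → StrictlySurjective _≡_ (to ψ)
  ≅-surjective ψ = Bijection.strictlySurjective (_≅ₚ_.bijection ψ)

  ≅-fold : (ψ : 𝓐 ≅ 𝓑) → ∀ n x → to ψ (fold x A.θ n) ≡ fold (to ψ x) B.θ n
  ≅-fold ψ zero    x = refl
  ≅-fold ψ (suc n) x = trans (≅-homo ψ _) (cong B.θ (≅-fold ψ n x))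

module _ {𝓐 : MonounaryAlgebra a} {𝓑 : MonounaryAlgebra b} where
  private
    module A = MonounaryAlgebra 𝓐
    module B = MonounaryAlgebra 𝓑

  -- Serves the classification, where the natural map runs from the model into the given algebra
  -- while the isomorphism is wanted in the other direction.
  inverse-isomorphism : (f : A.Carrier → B.Carrier) → Homomorphic 𝓐 𝓑 f →
                        Injective _≡_ _≡_ f → StrictlySurjective _≡_ f → 𝓑 ≅ 𝓐
  inverse-isomorphism f hom inj surj = isomorphism
    (bijective f⁻¹
      (λ {y} {z} eq → trans (sym (f∘f⁻¹ y)) (trans (cong f eq) (f∘f⁻¹ z)))
      (λ x → f x , inj (f∘f⁻¹ (f x))))
    (λ y → inj (trans (f∘f⁻¹ _) (trans (cong B.θ (sym (f∘f⁻¹ y))) (sym (hom _)))))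
    where
    f⁻¹ : B.Carrier → A.Carrier
    f⁻¹ y = proj₁ (surj y)

    f∘f⁻¹ : ∀ y → f (f⁻¹ y) ≡ y
    f∘f⁻¹ y = proj₂ (surj y)

≅-refl : {𝓐 : MonounaryAlgebra a} → 𝓐 ≅ 𝓐
≅-refl = isomorphism (⤖-id _) (λ _ → refl)

≅-trans : {𝓐 : MonounaryAlgebra a} {𝓑 : MonounaryAlgebra b} {𝓒 : MonounaryAlgebra c} →
          𝓐 ≅ 𝓑 → 𝓑 ≅ 𝓒 → 𝓐 ≅ 𝓒
≅-trans {𝓐 = 𝓐} {𝓑} {𝓒} φ ψ =
  isomorphism (_≅ₚ_.bijection ψ ⤖-∘ _≅ₚ_.bijection φ)
    (λ x → trans (cong (to ψ) (≅-homo {𝓐 = 𝓐} {𝓑} φ x)) (≅-homo {𝓐 = 𝓑} {𝓒} ψ (to φ x)))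

module _ {𝓐 : MonounaryAlgebra a} {𝓑 : MonounaryAlgebra b} where

  ≅⇒≅ᵈ : 𝓐 ≅ 𝓑 → 𝓐 * ≅ᵈ 𝓑 *
  ≅⇒≅ᵈ ψ = record
    { bijection = _≅ₚ_.bijection ψ
    ; edge⇔     = λ x y → mk⇔
        (λ e → trans (sym (≅-homo ψ x)) (cong (to ψ) e))
        (λ e → ≅-injective ψ (trans (≅-homo ψ x) e))
    }

  ≅ᵈ⇒≅ : 𝓐 * ≅ᵈ 𝓑 * → 𝓐 ≅ 𝓑
  ≅ᵈ⇒≅ ψ = isomorphism (_≅ᵈ_.bijection ψ)
    (λ x → sym (fwd (_≅ᵈ_.edge⇔ ψ x _) refl))

-- Homogeneity for tuples, compared with the notions for substructures.

module TupleHomogeneity (𝓐 : MonounaryAlgebra a) where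
  open MonounaryAlgebra 𝓐

  infix 4 _≃_

  -- Entries may repeat: `eq⇔` makes `xs i ↦ ys i` well defined and injective, and `edge⇔` makes it
  -- an isomorphism of induced subdigraphs.
  record _≃_ {n : ℕ} (xs ys : Vector Carrier n) : Set a where
    field
      eq⇔   : ∀ i j → xs i ≡ xs j ⇔ ys i ≡ ys j
      edge⇔ : ∀ i j → θ (xs i) ≡ xs j ⇔ θ (ys i) ≡ ys j

  open _≃_ public

  TupleHomogeneous : ℕ → Set a
  TupleHomogeneous n =
    (xs ys : Vector Carrier n) → xs ≃ ys →
    Σ[ ψ ∈ 𝓐 ≅ 𝓐 ] (∀ i → to ψ (xs i) ≡ ys i)

  ≃-sym : ∀ {n} {xs ys : Vector Carrier n} → xs ≃ ys → ys ≃ xs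
  ≃-sym s = record
    { eq⇔ = λ i j → ⇔-sym (eq⇔ s i j) ; edge⇔ = λ i j → ⇔-sym (edge⇔ s i j) }

  ≃-trans : ∀ {n} {xs ys zs : Vector Carrier n} → xs ≃ ys → ys ≃ zs → xs ≃ zs
  ≃-trans s t = record
    { eq⇔   = λ i j → eq⇔ t i j ⇔-∘ eq⇔ s i j
    ; edge⇔ = λ i j → edge⇔ t i j ⇔-∘ edge⇔ s i j
    }

  ≗⇒≃ : ∀ {n} {xs ys : Vector Carrier n} → xs ≗ ys → xs ≃ ys
  ≗⇒≃ eq = record
    { eq⇔   = λ i j → subst₂ (λ u v → _ ⇔ u ≡ v) (eq i) (eq j) (⇔-id _)
    ; edge⇔ = λ i j → subst₂ (λ u v → _ ⇔ θ u ≡ v) (eq i) (eq j) (⇔-id _)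
    }

  ≅⇒≃ : (ψ : 𝓐 ≅ 𝓐) → ∀ {n} (xs : Vector Carrier n) → xs ≃ to ψ ∘ xs
  ≅⇒≃ ψ xs = record
    { eq⇔   = λ i j → mk⇔ (cong (to ψ)) (≅-injective ψ)
    ; edge⇔ = λ i j → _≅ᵈ_.edge⇔ (≅⇒≅ᵈ {𝓐 = 𝓐} {𝓐} ψ) (xs i) (xs j)
    }

  Image : ∀ {n} → Vector Carrier n → Pred Carrier a
  Image xs z = ∃[ i ] xs i ≡ z

  entry : ∀ {n} (xs : Vector Carrier n) → Fin n → Refinement Carrier (Image xs)
  entry xs i = xs i , [ i , refl ]

  -- The enumeration `f` turns `φ` into the pair of tuples `f` and `φ ∘ f`. An edge between two
  -- members of `B` puts its source into the domain of the partial operation, so `homo` carries it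
  -- over.
  homogeneous⇒partiallyNHomogeneous : ∀ {n} →
    TupleHomogeneous n → PartiallyNHomogeneous 𝓐 n
  homogeneous⇒partiallyNHomogeneous hom B B′ f g φ =
    let (ψ , ext) = hom (value ∘ f.to) (value ∘ to φ ∘ f.to) same in
    ψ , λ x → let (i , fi≡x) = f.strictlySurjective x in
              subst (λ x → to ψ (value x) ≡ value (to φ x)) fi≡x (ext i)
    where
    module f = Bijection f
    module φ = _≅ₚ_ φ
    injective = Bijection.injective φ.bijection

    same : value ∘ f.to ≃ value ∘ to φ ∘ f.to
    same = record
      { eq⇔   = λ i j → mk⇔
          (cong (value ∘ to φ) ∘ value-injective)
          (cong value ∘ injective ∘ value-injective)
      ; edge⇔ = λ i j → mk⇔ (forth (f.to i) (f.to j)) (back (f.to i) (f.to j))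
      }
      where
      image : ∀ x .(d : B (θ (value x))) .(d′ : B′ (θ (value (to φ x)))) →
              value (to φ (θ (value x) , [ d ])) ≡ θ (value (to φ x))
      image x d d′ = cong value (φ.homo x d d′)

      forth : ∀ x y → θ (value x) ≡ value y →
              θ (value (to φ x)) ≡ value (to φ y)
      forth x (_ , [ d ]) refl = sym (image x d (fwd (φ.dom⇔ x) d))

      back : ∀ x y → θ (value (to φ x)) ≡ value (to φ y) →
             θ (value x) ≡ value y
      back x y = via (to φ y) refl
        where
        -- Generalising `to φ y` to a variable `w` lets the edge be matched with `refl`; the
        -- membership proof inside `w` then says that `to φ x` lies in the domain, hence so does
        -- `x`.
        via : ∀ w → to φ y ≡ w → θ (value (to φ x)) ≡ value w → θ (value x) ≡ value y
        via (_ , [ q ]) φy≡w refl = cong value (injective {θ (value x) , [ bwd (φ.dom⇔ x) q ]}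
          (value-injective (trans (image x (bwd (φ.dom⇔ x) q) q) (cong value (sym φy≡w)))))

  -- An isomorphism of generated subalgebras is determined by its values on the generators, so an
  -- automorphism with these values agrees with it by induction on generation.
  homogeneous⇒NUltrahomogeneous : ExcludedMiddle a → ∀ {n} →
    TupleHomogeneous n → NUltrahomogeneous 𝓐 n
  homogeneous⇒NUltrahomogeneous em hom xs ys φ =
    let (ψ , ext) = hom xs (value ∘ to φ ∘ gen) same in
    -- Excluded middle turns the irrelevant proof of generation into one that can be recursed on.
    ψ , λ (x , [ g ]) → agree ψ ext (recompute em g)
    where
    gen : ∀ i → Refinement Carrier (Generated 𝓐 xs)
    gen i = xs i , [ generator i ]

    φ-homo : Homomorphic (generatedSubalgebra 𝓐 xs) (generatedSubalgebra 𝓐 ys) (to φ)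
    φ-homo = ≅-homo φ

    same : xs ≃ value ∘ to φ ∘ gen
    same = record
      { eq⇔   = λ i j → mk⇔
          (cong (value ∘ to φ) ∘ value-injective)
          (cong value ∘ ≅-injective φ ∘ value-injective)
      ; edge⇔ = λ i j → mk⇔
          (λ e → trans (sym (cong value (φ-homo (gen i))))
                   (cong (value ∘ to φ) (value-injective e)))
          (λ e → cong value (≅-injective φ
                   (value-injective (trans (cong value (φ-homo (gen i))) e))))
      }

    agree : (ψ : 𝓐 ≅ 𝓐) → (∀ i → to ψ (xs i) ≡ value (to φ (gen i))) →
            ∀ {x} (g : Generated 𝓐 xs x) → to ψ x ≡ value (to φ (x , [ g ]))
    agree ψ ext (generator i)    = ext i
    agree ψ ext (closed {x} g) =
      trans (≅-homo ψ x) (trans (cong θ (agree ψ ext g))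
        (sym (cong value (φ-homo (x , [ g ])))))

  module _ (em : ExcludedMiddle a) where

    index : ∀ {n} (xs : Vector Carrier n) (z : Refinement Carrier (Image xs)) →
            ∃[ i ] xs i ≡ value z
    index xs (z , [ p ]) = recompute em p

    imageMap : ∀ {n} (xs ys : Vector Carrier n) →
               Refinement Carrier (Image xs) → Refinement Carrier (Image ys)
    imageMap xs ys z = entry ys (proj₁ (index xs z))

    module _ {n} {xs ys : Vector Carrier n} (s : xs ≃ ys) where

      -- The position picked by `index` does not matter: positions with equal entries in `xs` have
      -- equal entries in `ys`.
      imageMap-value : ∀ z {i} → xs i ≡ value z → ys i ≡ value (imageMap xs ys z)
      imageMap-value z {i} p = let (j , q) = index xs z in
        fwd (eq⇔ s i j) (trans p (sym q))

      imageBijection : Refinement Carrier (Image xs) ⤖ Refinement Carrier (Image ys)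
      imageBijection = bijective (imageMap xs ys)
        (λ {z} {w} eq →
          let (i , p) = index xs z
              (j , q) = index xs w
          in value-injective (trans (sym p) (trans (bwd (eq⇔ s i j)
               (trans (imageMap-value z p) (trans (cong value eq) (sym (imageMap-value w q))))) q)))
        (λ w → let (i , p) = index ys w in
               entry xs i , value-injective (trans (sym (imageMap-value (entry xs i) refl)) p))

      imageEdge⇔ : ∀ z w → θ (value z) ≡ value w ⇔
                   θ (value (imageMap xs ys z)) ≡ value (imageMap xs ys w)
      imageEdge⇔ z w =
        let (i , p) = index xs z
            (j , q) = index xs w
            p′ = imageMap-value z p
            q′ = imageMap-value w q
        in mk⇔
          (λ e → trans (cong θ (sym p′)) (trans (fwd (edge⇔ s i j)
                   (trans (cong θ p) (trans e (sym q)))) q′))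
          (λ e → trans (cong θ (sym p)) (trans (bwd (edge⇔ s i j)
                   (trans (cong θ p′) (trans e (sym q′)))) q))

      digraphIso : generatedSubdigraph (𝓐 *) xs ≅ᵈ generatedSubdigraph (𝓐 *) ys
      digraphIso = record { bijection = imageBijection ; edge⇔ = imageEdge⇔ }

      -- The domain is visible in the edges: `θ` is defined at a point of the image exactly when an
      -- edge leads from that point to some entry.
      partialIso : partialSubalgebra 𝓐 (Image xs) ≅ₚ partialSubalgebra 𝓐 (Image ys)
      partialIso = record
        { bijection = imageBijection
        ; dom⇔      = λ z → mk⇔
            (λ d → let (j , q) = index ys (imageMap xs ys (θ (value z) , [ d ])) in
                   j , trans q (sym (fwd (imageEdge⇔ z (θ (value z) , [ d ])) refl)))
            (λ (j , q) → let (i , p) = index xs z in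
               j , sym (trans (cong θ (sym p)) (bwd (edge⇔ s i j)
                     (trans (cong θ (imageMap-value z p)) (sym q)))))
        ; homo      = λ z d _ →
            value-injective (sym (fwd (imageEdge⇔ z (θ (value z) , [ d ])) refl))
        }

    ultrahomogeneousᵈ⇒homogeneous : ∀ {n} →
      NUltrahomogeneousᵈ (𝓐 *) n → TupleHomogeneous n
    ultrahomogeneousᵈ⇒homogeneous hom xs ys s =
      let (ψ , ext) = hom xs ys (digraphIso s) in
      ≅ᵈ⇒≅ {𝓐 = 𝓐} {𝓐} ψ , λ i → trans (ext (entry xs i)) (sym (imageMap-value s (entry xs i) refl))

    homogeneous⇒ultrahomogeneousᵈ : ∀ {n} →
      TupleHomogeneous n → NUltrahomogeneousᵈ (𝓐 *) n
    homogeneous⇒ultrahomogeneousᵈ hom xs ys φ =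
      let (ψ , ext) = hom xs (value ∘ φ.to ∘ entry xs) same in
      ≅⇒≅ᵈ {𝓐 = 𝓐} {𝓐} ψ , λ x →
        let (i , p) = index xs x in
        trans (cong (to ψ) (sym p))
          (trans (ext i) (cong (value ∘ φ.to) (value-injective p)))
      where
      module φ = _≅ᵈ_ φ

      same : xs ≃ value ∘ φ.to ∘ entry xs
      same = record
        { eq⇔   = λ i j → mk⇔
            (cong (value ∘ φ.to) ∘ value-injective)
            (cong value ∘ Bijection.injective φ.bijection ∘ value-injective)
        ; edge⇔ = λ i j → φ.edge⇔ (entry xs i) (entry xs j)
        }

    -- Injectivity ensures that the two images have exactly `n` elements.
    partiallyNHomogeneous⇒homogeneous-injective : ∀ {n} →
      PartiallyNHomogeneous 𝓐 n → (xs ys : Vector Carrier n) →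
      Injective _≡_ _≡_ xs → xs ≃ ys → Σ[ ψ ∈ 𝓐 ≅ 𝓐 ] (∀ i → to ψ (xs i) ≡ ys i)
    partiallyNHomogeneous⇒homogeneous-injective hom xs ys inj s =
      let (ψ , ext) = hom (Image xs) (Image ys)
                        (entries xs inj) (entries ys (inj ∘ bwd (eq⇔ s _ _))) (partialIso s)
      in ψ , λ i → trans (ext (entry xs i)) (sym (imageMap-value s (entry xs i) refl))
      where
      entries : ∀ {n} (zs : Vector Carrier n) → Injective _≡_ _≡_ zs →
                Fin n ⤖ Refinement Carrier (Image zs)
      entries zs inj = bijective (entry zs) (inj ∘ cong value)
        (λ z → let (i , p) = index zs z in i , value-injective p)

    -- A pair with distinct entries has an image of size two, and a constant pair has an image of
    -- size one; hence both sizes are used.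
    partially₁₂⇒homogeneous₂ : PartiallyNHomogeneous 𝓐 1 →
      PartiallyNHomogeneous 𝓐 2 → TupleHomogeneous 2
    partially₁₂⇒homogeneous₂ hom₁ hom₂ xs ys s with em {xs zero ≡ xs (suc zero)}
    ... | no x≢x′ = partiallyNHomogeneous⇒homogeneous-injective hom₂ xs ys injective s
      where
      injective : Injective _≡_ _≡_ xs
      injective {zero}     {zero}     _ = refl
      injective {zero}     {suc zero} e = contradiction e x≢x′
      injective {suc zero} {zero}     e = contradiction (sym e) x≢x′
      injective {suc zero} {suc zero} _ = refl
    ... | yes x≡x′ =
      let (ψ , ext) = partiallyNHomogeneous⇒homogeneous-injective hom₁
                        (λ _ → xs zero) (λ _ → ys zero) (λ { {zero} {zero} _ → refl })
                        (record { eq⇔ = λ _ _ → mk⇔ (λ _ → refl) (λ _ → refl)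
                                ; edge⇔ = λ _ _ → edge⇔ s zero zero })
      in ψ , λ { zero       → ext zero
               ; (suc zero) → trans (cong (to ψ) (sym x≡x′))
                                (trans (ext zero) (fwd (eq⇔ s zero (suc zero)) x≡x′)) }

-- Orbits, cyclic algebras and normal forms.

module Orbits (𝓐 : MonounaryAlgebra a) where
  open MonounaryAlgebra 𝓐

  θ^ : ℕ → Carrier → Carrier
  θ^ n x = fold x θ n

  Fixed NonFixed : Pred Carrier a
  Fixed x    = θ x ≡ x
  NonFixed x = ¬ Fixed x

  infix 4 _∈⟨_⟩

  _∈⟨_⟩ : Carrier → Carrier → Set a
  y ∈⟨ x ⟩ = ∃[ m ] y ≡ θ^ m x

  θ^-+ : ∀ m n x → θ^ (m ℕ.+ n) x ≡ θ^ m (θ^ n x)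
  θ^-+ m n x = fold-+ x θ m

  θ^-comm : ∀ m n x → θ^ m (θ^ n x) ≡ θ^ n (θ^ m x)
  θ^-comm m n x = trans (sym (θ^-+ m n x))
    (trans (cong (λ l → θ^ l x) (+-comm m n)) (θ^-+ n m x))

  θ^-fixed : ∀ {x} → Fixed x → ∀ n → θ^ n x ≡ x
  θ^-fixed eq zero    = refl
  θ^-fixed eq (suc n) = trans (cong θ (θ^-fixed eq n)) eq

  -- For positive `k`: every orbit is a cycle of length one or `k`.
  record Cyclic (k : ℕ) : Set a where
    field
      period : ∀ x → θ^ k x ≡ x
      free   : ∀ {x} → NonFixed x → ∀ {d} → 0 < d → d < k → θ^ d x ≢ x

  module CyclicProperties {k : ℕ} (cyclic : Cyclic (suc k)) where
    open Cyclic cyclic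

    θ-injective : Injective _≡_ _≡_ θ
    θ-injective {x} {y} eq =
      trans (sym (period x)) (trans (θ^-comm 1 k x) (trans (cong (θ^ k) eq)
        (trans (θ^-comm k 1 y) (period y))))

    θ^-injective : ∀ n → Injective _≡_ _≡_ (θ^ n)
    θ^-injective zero    eq = eq
    θ^-injective (suc n) eq = θ^-injective n (θ-injective eq)

    θ^-multiple : ∀ q x → θ^ (q ℕ.* suc k) x ≡ x
    θ^-multiple zero    x = refl
    θ^-multiple (suc q) x = trans (θ^-+ (suc k) (q ℕ.* suc k) x)
      (trans (period _) (θ^-multiple q x))

    θ^-mod : ∀ m x → θ^ (toℕ (m mod suc k)) x ≡ θ^ m x
    θ^-mod m x = begin
      θ^ (toℕ (m mod suc k)) x
        ≡⟨ cong (λ l → θ^ l x) (toℕ-fromℕ< (m%n<n m (suc k))) ⟩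
      θ^ (m % suc k) x
        ≡⟨ cong (θ^ (m % suc k)) (θ^-multiple (m / suc k) x) ⟨
      θ^ (m % suc k) (θ^ (m / suc k ℕ.* suc k) x)
        ≡⟨ θ^-+ (m % suc k) _ x ⟨
      θ^ (m % suc k ℕ.+ m / suc k ℕ.* suc k) x
        ≡⟨ cong (λ l → θ^ l x) (m≡m%n+[m/n]*n m (suc k)) ⟨
      θ^ m x ∎
      where open ≡-Reasoning

    -- Cancelling `θ^ m` leaves a return to `x` after `n ∸ m` steps, too few for a non-fixed point.
    θ^-≢ : ∀ {x} → NonFixed x → ∀ {m n} → m < n → n < suc k → θ^ m x ≢ θ^ n x
    θ^-≢ {x} nf {m} {n} m<n n<k e = free nf (m<n⇒0<n∸m m<n) (≤-<-trans (m∸n≤m n m) n<k)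
      (θ^-injective m (trans (sym (θ^-+ m (n ℕ.∸ m) x))
        (trans (cong (λ l → θ^ l x) (m+[n∸m]≡n (<⇒≤ m<n))) (sym e))))

    θ^-distinct : ∀ {x} → NonFixed x → (i j : Fin (suc k)) →
                  θ^ (toℕ i) x ≡ θ^ (toℕ j) x → i ≡ j
    θ^-distinct nf i j eq with <-cmp (toℕ i) (toℕ j)
    ... | tri< i<j _ _ = contradiction eq (θ^-≢ nf i<j (toℕ<n j))
    ... | tri≈ _ i≡j _ = toℕ-injective i≡j
    ... | tri> _ _ j<i = contradiction (sym eq) (θ^-≢ nf j<i (toℕ<n i))

    mod-≡ : ∀ {x} → NonFixed x → ∀ m n → θ^ m x ≡ θ^ n x → m mod suc k ≡ n mod suc k
    mod-≡ {x} nf m n eq = θ^-distinct nf (m mod suc k) (n mod suc k)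
      (trans (θ^-mod m x) (trans eq (sym (θ^-mod n x))))

    -- `θ^ k` undoes `θ`, so orbits are closed under preimages as well.
    ∈⟨⟩-θ⁻¹ : ∀ {x z} → θ z ∈⟨ x ⟩ → z ∈⟨ x ⟩
    ∈⟨⟩-θ⁻¹ {x} {z} (m , eq) = k ℕ.+ m ,
      trans (sym (period z)) (trans (θ^-comm 1 k z)
        (trans (cong (θ^ k) eq) (sym (θ^-+ k m x))))

    ∈⟨⟩-θ^⁻¹ : ∀ {x z} n → θ^ n z ∈⟨ x ⟩ → z ∈⟨ x ⟩
    ∈⟨⟩-θ^⁻¹ zero    p = p
    ∈⟨⟩-θ^⁻¹ (suc n) p = ∈⟨⟩-θ^⁻¹ n (∈⟨⟩-θ⁻¹ p)

    ∈⟨⟩-sym : ∀ {x y} → y ∈⟨ x ⟩ → x ∈⟨ y ⟩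
    ∈⟨⟩-sym (m , eq) = ∈⟨⟩-θ^⁻¹ m (0 , sym eq)

    ∈⟨⟩-mod : ∀ {x y} → y ∈⟨ x ⟩ → ∃[ i ] y ≡ θ^ (toℕ {suc k} i) x
    ∈⟨⟩-mod {x} (m , eq) = m mod suc k , trans eq (sym (θ^-mod m x))

    NonFixed-θ^ : ∀ {x} m → NonFixed x → NonFixed (θ^ m x)
    NonFixed-θ^ {x} m nf eq = nf (θ^-injective m (trans (θ^-comm m 1 x) eq))

  ∈⟨⟩-refl : ∀ {x} → x ∈⟨ x ⟩
  ∈⟨⟩-refl = 0 , refl

  ∈⟨⟩-trans : ∀ {x y z} → z ∈⟨ y ⟩ → y ∈⟨ x ⟩ → z ∈⟨ x ⟩
  ∈⟨⟩-trans {x} (m , p) (n , q) = m ℕ.+ n , trans p (trans (cong (θ^ m) q) (sym (θ^-+ m n x)))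

  ∈⟨⟩-θ : ∀ {x z} → z ∈⟨ x ⟩ → θ z ∈⟨ x ⟩
  ∈⟨⟩-θ (m , p) = suc m , cong θ p

  cyclic₂ : (∀ x → θ^ 2 x ≡ x) → Cyclic 2
  cyclic₂ period = record { period = period ; free = free }
    where
    free : ∀ {x} → NonFixed x → ∀ {d} → 0 < d → d < 2 → θ^ d x ≢ x
    free nf {suc zero}    _ _ = nf
    free nf {suc (suc d)} _ (s<s (s<s ()))

  cyclic₃ : (∀ x → θ^ 3 x ≡ x) → Cyclic 3
  cyclic₃ period = record { period = period ; free = free }
    where
    free : ∀ {x} → NonFixed x → ∀ {d} → 0 < d → d < 3 → θ^ d x ≢ x
    free nf {1}                 _ _ = nf
    -- Periods 2 and 3 together give period 1.
    free nf {2}                 _ _ = λ e → nf (trans (cong θ (sym e)) (period _))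
    free nf {suc (suc (suc d))} _ (s<s (s<s (s<s ())))

  cyclic₄ : (∀ x → θ^ 4 x ≡ x) → (∀ x → NonFixed x → θ^ 2 x ≢ x) → Cyclic 4
  cyclic₄ period square = record { period = period ; free = free }
    where
    free : ∀ {x} → NonFixed x → ∀ {d} → 0 < d → d < 4 → θ^ d x ≢ x
    free nf {1}                       _ _ = nf
    free nf {2}                       _ _ = square _ nf
    free nf {3}                       _ _ = λ e → nf (trans (cong θ (sym e)) (period _))
    free nf {suc (suc (suc (suc d)))} _ (s<s (s<s (s<s (s<s ()))))

  -- The five families of the classification as conditions on `θ` alone. They mention no cardinals
  -- and no choice of representatives, and are easy to verify and to apply.
  data Normal : Set a where
    all-θ²≡id : (∀ x → θ^ 2 x ≡ x) → Normal
    all-θ³≡id : (∀ x → θ^ 3 x ≡ x) → Normal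
    one-4-cycle : (∀ x → θ^ 4 x ≡ x) → (∀ x → NonFixed x → θ^ 2 x ≢ x) →
                  ∃[ x ] NonFixed x → (∀ x y → NonFixed x → NonFixed y → y ∈⟨ x ⟩) → Normal
    tails : (∀ x → Fixed (θ x)) → (∀ x → Fixed x → ∃[ y ] NonFixed y × θ y ≡ x) →
            (∀ x y → NonFixed x → NonFixed y → θ x ≡ θ y → x ≡ y) → Normal
    constant : (∀ x y → θ x ≡ θ y) → Normal

-- Extension by swaps and rotations: normal forms are homogeneous.

module Automorphisms (𝓐 : MonounaryAlgebra a) (em : ExcludedMiddle a) where
  open MonounaryAlgebra 𝓐
  open TupleHomogeneity 𝓐
  open Orbits 𝓐

  -- What makes the exchange of `θ^ i x` and `θ^ i y` for all `i` an automorphism: `forth` and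
  -- `back` make it well defined on each orbit, `cross` on their overlap, and the last two fields
  -- let points outside both orbits map into them only where the exchange moves nothing.
  record Swappable (x y : Carrier) : Set a where
    field
      forth : ∀ i j → θ^ i x ≡ θ^ j x → θ^ i y ≡ θ^ j y
      back  : ∀ i j → θ^ i y ≡ θ^ j y → θ^ i x ≡ θ^ j x
      cross : ∀ i j → θ^ i x ≡ θ^ j y → θ^ i y ≡ θ^ j x
      above-x : ∀ z i → θ z ≡ θ^ i x → (z ∈⟨ x ⟩ ⊎ z ∈⟨ y ⟩) ⊎ θ^ i x ≡ θ^ i y
      above-y : ∀ z i → θ z ≡ θ^ i y → (z ∈⟨ x ⟩ ⊎ z ∈⟨ y ⟩) ⊎ θ^ i x ≡ θ^ i y

  module Swap {x y : Carrier} (s : Swappable x y) where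
    open Swappable s

    swap : Carrier → Carrier
    swap z with em {z ∈⟨ x ⟩} | em {z ∈⟨ y ⟩}
    ... | yes (i , _) | _           = θ^ i y
    ... | no _        | yes (i , _) = θ^ i x
    ... | no _        | no _        = z

    swap-x : ∀ i → swap (θ^ i x) ≡ θ^ i y
    swap-x i with em {θ^ i x ∈⟨ x ⟩} | em {θ^ i x ∈⟨ y ⟩}
    ... | yes (j , e) | _ = sym (forth i j e)
    ... | no x∉       | _ = contradiction (i , refl) x∉

    swap-y : ∀ i → swap (θ^ i y) ≡ θ^ i x
    swap-y i with em {θ^ i y ∈⟨ x ⟩} | em {θ^ i y ∈⟨ y ⟩}
    -- Here `θ^ i y` also lies in the orbit of `x`, where the first clause of `swap` takes
    -- precedence.
    ... | yes (j , e) | _           = cross j i (sym e)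
    ... | no _        | yes (j , e) = sym (back i j e)
    ... | no _        | no y∉       = contradiction (i , refl) y∉

    swap-other : ∀ {z} → ¬ z ∈⟨ x ⟩ → ¬ z ∈⟨ y ⟩ → swap z ≡ z
    swap-other {z} z∉x z∉y with em {z ∈⟨ x ⟩} | em {z ∈⟨ y ⟩}
    ... | yes z∈x | _       = contradiction z∈x z∉x
    ... | no _    | yes z∈y = contradiction z∈y z∉y
    ... | no _    | no _    = refl

    by-cases : (P : Pred Carrier a) → (∀ i → P (θ^ i x)) → (∀ i → P (θ^ i y)) →
               (∀ {z} → ¬ z ∈⟨ x ⟩ → ¬ z ∈⟨ y ⟩ → P z) → ∀ z → P z
    by-cases P px py po z with em {z ∈⟨ x ⟩} | em {z ∈⟨ y ⟩}
    ... | yes (i , refl) | _              = px i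
    ... | no _           | yes (i , refl) = py i
    ... | no z∉x         | no z∉y         = po z∉x z∉y

    swap-involutive : ∀ z → swap (swap z) ≡ z
    swap-involutive = by-cases _
      (λ i → trans (cong swap (swap-x i)) (swap-y i))
      (λ i → trans (cong swap (swap-y i)) (swap-x i))
      (λ z∉x z∉y → trans (cong swap (swap-other z∉x z∉y)) (swap-other z∉x z∉y))

    swap-homo : Homomorphic 𝓐 𝓐 swap
    swap-homo = by-cases _
      (λ i → trans (swap-x (suc i)) (cong θ (sym (swap-x i))))
      (λ i → trans (swap-y (suc i)) (cong θ (sym (swap-y i))))
      (λ z∉x z∉y → trans (other z∉x z∉y) (cong θ (sym (swap-other z∉x z∉y))))
      where
      -- If `θ z` enters an orbit from outside, it does so at a point `θ^ i x ≡ θ^ i y`, which the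
      -- exchange fixes.
      other : ∀ {z} → ¬ z ∈⟨ x ⟩ → ¬ z ∈⟨ y ⟩ → swap (θ z) ≡ θ z
      other {z} z∉x z∉y with em {θ z ∈⟨ x ⟩} | em {θ z ∈⟨ y ⟩}
      ... | no _ | no _ = refl
      ... | yes (i , e) | _ with above-x z i e
      ...   | inj₁ (inj₁ z∈x) = contradiction z∈x z∉x
      ...   | inj₁ (inj₂ z∈y) = contradiction z∈y z∉y
      ...   | inj₂ x≡y        = trans (sym x≡y) (sym e)
      other {z} z∉x z∉y | no _ | yes (i , e) with above-y z i e
      ...   | inj₁ (inj₁ z∈x) = contradiction z∈x z∉x
      ...   | inj₁ (inj₂ z∈y) = contradiction z∈y z∉y
      ...   | inj₂ x≡y        = trans x≡y (sym e)

    automorphism : 𝓐 ≅ 𝓐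
    automorphism = isomorphism
      (bijective swap
        (λ {u} {v} e → trans (sym (swap-involutive u)) (trans (cong swap e) (swap-involutive v)))
        (λ z → swap z , swap-involutive z))
      swap-homo

  module Rotation {k : ℕ} (cyclic : Cyclic (suc k)) (x : Carrier) (j : ℕ) where
    open CyclicProperties cyclic

    rotate : Carrier → Carrier
    rotate z with em {z ∈⟨ x ⟩}
    ... | yes _ = θ^ j z
    ... | no _  = z

    rotate-∈ : ∀ {z} → z ∈⟨ x ⟩ → rotate z ≡ θ^ j z
    rotate-∈ {z} z∈x with em {z ∈⟨ x ⟩}
    ... | yes _  = refl
    ... | no z∉x = contradiction z∈x z∉x

    rotate-∉ : ∀ {z} → ¬ z ∈⟨ x ⟩ → rotate z ≡ z
    rotate-∉ {z} z∉x with em {z ∈⟨ x ⟩}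
    ... | yes z∈x = contradiction z∈x z∉x
    ... | no _    = refl

    θ^j-∈ : ∀ {z} → z ∈⟨ x ⟩ → θ^ j z ∈⟨ x ⟩
    θ^j-∈ = ∈⟨⟩-trans (j , refl)

    rotate-injective : Injective _≡_ _≡_ rotate
    rotate-injective {u} {v} e with em {u ∈⟨ x ⟩} | em {v ∈⟨ x ⟩}
    ... | yes _   | yes _   = θ^-injective j e
    ... | yes u∈x | no v∉x  = contradiction (subst (_∈⟨ x ⟩) e (θ^j-∈ u∈x)) v∉x
    ... | no u∉x  | yes v∈x = contradiction (subst (_∈⟨ x ⟩) (sym e) (θ^j-∈ v∈x)) u∉x
    ... | no _    | no _    = e

    rotate-surjective : StrictlySurjective _≡_ rotate
    rotate-surjective z with em {z ∈⟨ x ⟩}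
    ... | no z∉x  = z , rotate-∉ z∉x
    -- The power `j ℕ.* k` inverts `θ^ j`, since `j + j * k` is a multiple of the period `suc k`.
    ... | yes z∈x = θ^ (j ℕ.* k) z , trans (rotate-∈ (∈⟨⟩-trans (j ℕ.* k , refl) z∈x)) (begin
      θ^ j (θ^ (j ℕ.* k) z) ≡⟨ θ^-+ j (j ℕ.* k) z ⟨
      θ^ (j ℕ.+ j ℕ.* k) z  ≡⟨ cong (λ l → θ^ l z) (*-suc j k) ⟨
      θ^ (j ℕ.* suc k) z    ≡⟨ θ^-multiple j z ⟩
      z                     ∎)
      where open ≡-Reasoning

    rotate-homo : Homomorphic 𝓐 𝓐 rotate
    rotate-homo z with em {z ∈⟨ x ⟩}
    ... | yes z∈x = trans (rotate-∈ (∈⟨⟩-θ z∈x)) (θ^-comm j 1 z)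
    ... | no z∉x  = rotate-∉ (z∉x ∘ ∈⟨⟩-θ⁻¹)

    automorphism : 𝓐 ≅ 𝓐
    automorphism = isomorphism (bijective rotate rotate-injective rotate-surjective) rotate-homo

  OnePointExtension : ∀ {n} → Vector Carrier n → Carrier → Carrier → Set a
  OnePointExtension p x y =
    Σ[ ψ ∈ 𝓐 ≅ 𝓐 ] to ψ x ≡ y × (∀ i → to ψ (p i) ≡ p i)

  -- Induction on the length: once the tails are matched by `φ`, it remains to move the image of the
  -- first entry to its target while fixing the tail already reached.
  one-point⇒homogeneous :
    (∀ {n} (p : Vector Carrier n) x y → x ≢ y → x ∷ p ≃ y ∷ p → OnePointExtension p x y) →
    ∀ n → TupleHomogeneous n
  one-point⇒homogeneous extend zero    xs ys s = ≅-refl {𝓐 = 𝓐} , λ ()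
  one-point⇒homogeneous extend (suc n) xs ys s =
    let (φ , φ-ext)      = one-point⇒homogeneous extend n (tail xs) (tail ys)
                             (record { eq⇔   = λ i j → eq⇔ s (suc i) (suc j)
                                     ; edge⇔ = λ i j → edge⇔ s (suc i) (suc j) })
        -- The chain of relations runs from `to φ ∘ xs` through `xs` to `ys`; its two ends share the
        -- tail of `ys`.
        (ψ , ψ-x , ψ-ext) = extend′ (to φ (xs zero)) (≃-trans
          (≗⇒≃ λ { zero → refl ; (suc i) → sym (φ-ext i) })
          (≃-trans (≃-sym (≅⇒≃ φ xs)) (≃-trans s (≗⇒≃ λ { zero → refl ; (suc i) → refl }))))
    in ≅-trans {𝓐 = 𝓐} {𝓐} {𝓐} φ ψ , λ
      { zero    → ψ-x
      ; (suc i) → trans (cong (to ψ) (φ-ext i)) (ψ-ext i) }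
    where
    extend′ : ∀ x → x ∷ tail ys ≃ ys zero ∷ tail ys → OnePointExtension (tail ys) x (ys zero)
    extend′ x s with em {x ≡ ys zero}
    ... | yes x≡y = ≅-refl {𝓐 = 𝓐} , x≡y , λ _ → refl
    ... | no x≢y  = extend (tail ys) x (ys zero) x≢y s

  module _ {n} {p : Vector Carrier n} {x y : Carrier} (x≢y : x ≢ y) (s : x ∷ p ≃ y ∷ p) where

    -- `x` and `y` stand in the same relations to each `p i`, so a relation that determines `x` from
    -- `p i` would determine `y` as the same point.
    ≢-entry : ∀ i → x ≢ p i
    ≢-entry i e = x≢y (trans e (sym (fwd (eq⇔ s zero (suc i)) e)))

    θ-entry-≢ : ∀ i → θ (p i) ≢ x
    θ-entry-≢ i e = x≢y (trans (sym e) (fwd (edge⇔ s (suc i) zero) e))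

    θx≡entry⇒θx≡θy : ∀ i → θ x ≡ p i → θ x ≡ θ y
    θx≡entry⇒θx≡θy i e = trans e (sym (fwd (edge⇔ s zero (suc i)) e))

  Avoids : ∀ {n} → Vector Carrier n → Carrier → Set a
  Avoids p x = ∀ i → ¬ p i ∈⟨ x ⟩

  module _ {k : ℕ} (cyclic : Cyclic (suc k)) where
    open CyclicProperties cyclic

    module _ {n} {p : Vector Carrier n} {x y : Carrier} (x≢y : x ≢ y) (s : x ∷ p ≃ y ∷ p) where

      cyclic-θ-≢ : ∀ i → θ x ≢ p i
      cyclic-θ-≢ i e = x≢y (θ-injective (θx≡entry⇒θx≡θy x≢y s i e))

    -- For non-fixed `x` the equation forces `i` and `j` to be congruent modulo the period, which
    -- gives it for every `y`.
    cyclic-forth : ∀ {x y} → (Fixed x → Fixed y) →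
                   ∀ i j → θ^ i x ≡ θ^ j x → θ^ i y ≡ θ^ j y
    cyclic-forth {x} {y} fix i j e with em {Fixed x}
    ... | yes fx = trans (θ^-fixed (fix fx) i) (sym (θ^-fixed (fix fx) j))
    ... | no nfx = trans (sym (θ^-mod i y))
      (trans (cong (λ l → θ^ (toℕ l) y) (mod-≡ nfx i j e)) (θ^-mod j y))

    -- Different cycles are disjoint and receive no edges from outside.
    cyclic-swappable : ∀ {x y} → (Fixed x → Fixed y) → (Fixed y → Fixed x) →
                       ¬ y ∈⟨ x ⟩ → Swappable x y
    cyclic-swappable fix fix′ y∉x = record
      { forth   = cyclic-forth fix
      ; back    = cyclic-forth fix′
      ; cross   = λ i j e → contradiction (∈⟨⟩-θ^⁻¹ j (i , sym e)) y∉x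
      ; above-x = λ z i e → inj₁ (inj₁ (∈⟨⟩-θ⁻¹ (i , e)))
      ; above-y = λ z i e → inj₁ (inj₂ (∈⟨⟩-θ⁻¹ (i , e)))
      }

    -- Within one cycle `x` is rotated to `y`; otherwise the two cycles are swapped. The entries of
    -- `p` lie off the points moved.
    cyclic-extension : ∀ {n} {p : Vector Carrier n} {x y} → x ∷ p ≃ y ∷ p →
                       Avoids p x → Avoids p y → OnePointExtension p x y
    cyclic-extension {x = x} {y} s p∉x p∉y with em {y ∈⟨ x ⟩}
    ... | yes (j , e) = Rotation.automorphism cyclic x j ,
      trans (Rotation.rotate-∈ cyclic x j ∈⟨⟩-refl) (sym e) ,
      λ i → Rotation.rotate-∉ cyclic x j (p∉x i)
    ... | no y∉x = automorphism , swap-x 0 , λ i → swap-other (p∉x i) (p∉y i)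
      where open Swap (cyclic-swappable (fwd (edge⇔ s zero zero)) (bwd (edge⇔ s zero zero)) y∉x)

  cyclic₂-avoids : Cyclic 2 → ∀ {n} {p : Vector Carrier n} {x y} → x ≢ y →
                   x ∷ p ≃ y ∷ p → Avoids p x
  cyclic₂-avoids cyclic x≢y s i p∈x with CyclicProperties.∈⟨⟩-mod cyclic p∈x
  ... | zero     , e = ≢-entry x≢y s i (sym e)
  ... | suc zero , e = cyclic-θ-≢ cyclic x≢y s i (sym e)

  -- A cycle of length three consists of `x`, its successor and its predecessor, and no entry can be
  -- any of these.
  cyclic₃-avoids : Cyclic 3 → ∀ {n} {p : Vector Carrier n} {x y} → x ≢ y →
                   x ∷ p ≃ y ∷ p → Avoids p x
  cyclic₃-avoids cyclic x≢y s i p∈x with CyclicProperties.∈⟨⟩-mod cyclic p∈x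
  ... | zero           , e = ≢-entry x≢y s i (sym e)
  ... | suc zero       , e = cyclic-θ-≢ cyclic x≢y s i (sym e)
  ... | suc (suc zero) , e = θ-entry-≢ x≢y s i (trans (cong θ e) (Cyclic.period cyclic _))

  one-4-cycle-avoids : Cyclic 4 → (∀ x y → NonFixed x → NonFixed y → y ∈⟨ x ⟩) →
                       ∀ {n} {p : Vector Carrier n} {x y} → x ≢ y →
                       x ∷ p ≃ y ∷ p → Avoids p x
  one-4-cycle-avoids cyclic one {p = p} {x} {y} x≢y s i p∈x
    with ∈⟨⟩-mod p∈x | em {Fixed x}
    where open CyclicProperties cyclic
  ... | j , e                    | yes fx = ≢-entry x≢y s i (sym (trans e (θ^-fixed fx (toℕ j))))
  ... | zero , e                 | no _   = ≢-entry x≢y s i (sym e)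
  ... | suc zero , e             | no _   = cyclic-θ-≢ cyclic x≢y s i (sym e)
  ... | suc (suc (suc zero)) , e | no _   =
    θ-entry-≢ x≢y s i (trans (cong θ e) (Cyclic.period cyclic _))
  -- The entry is opposite to `x`, so no edge joins them. But `y` lies on the same 4-cycle, and
  -- wherever it differs from `x` it equals the entry or is adjacent to it.
  ... | suc (suc zero) , e       | no nfx
    with CyclicProperties.∈⟨⟩-mod cyclic (one x y nfx (nfx ∘ bwd (edge⇔ s zero zero)))
  ...   | zero                 , f = x≢y (sym f)
  ...   | suc zero             , f =
    cyclic-θ-≢ cyclic (x≢y ∘ sym) (≃-sym s) i (trans (cong θ f) (sym e))
  ...   | suc (suc zero)       , f = ≢-entry (x≢y ∘ sym) (≃-sym s) i (trans f (sym e))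
  ...   | suc (suc (suc zero)) , f = θ-entry-≢ (x≢y ∘ sym) (≃-sym s) i (trans (cong θ e) (sym f))

  module _ (idem : ∀ x → Fixed (θ x)) where

    θ^-suc : ∀ m x → θ^ (suc m) x ≡ θ x
    θ^-suc zero    x = refl
    θ^-suc (suc m) x = trans (idem _) (θ^-suc m x)

    ≢-θ^-suc : ∀ {x} → NonFixed x → ∀ m z → x ≢ θ^ (suc m) z
    ≢-θ^-suc nfx m z e = nfx (trans (cong θ e) (trans (idem _) (sym e)))

    -- For non-fixed `x` the exponents are both zero or both positive, and all positive powers of
    -- `θ` coincide.
    idempotent-forth : ∀ {x y} → NonFixed x → ∀ i j → θ^ i x ≡ θ^ j x → θ^ i y ≡ θ^ j y
    idempotent-forth nfx zero    zero    e = refl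
    idempotent-forth nfx zero    (suc j) e = contradiction e (≢-θ^-suc nfx j _)
    idempotent-forth nfx (suc i) zero    e = contradiction (sym e) (≢-θ^-suc nfx i _)
    idempotent-forth nfx (suc i) (suc j) e = trans (θ^-suc i _) (sym (θ^-suc j _))

    idempotent-cross : ∀ {x y} → NonFixed x → NonFixed y →
                       ∀ i j → θ^ i x ≡ θ^ j y → θ^ i y ≡ θ^ j x
    idempotent-cross nfx nfy zero    zero    e = sym e
    idempotent-cross nfx nfy zero    (suc j) e = contradiction e (≢-θ^-suc nfx j _)
    idempotent-cross nfx nfy (suc i) zero    e = contradiction (sym e) (≢-θ^-suc nfy i _)
    idempotent-cross nfx nfy (suc i) (suc j) e =
      trans (θ^-suc i _) (trans
        (trans (sym (θ^-suc j _)) (trans (sym e) (θ^-suc i _)))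
        (sym (θ^-suc j _)))

    idempotent-above : ∀ {x y z} → NonFixed x → (θ z ≡ θ x → z ∈⟨ x ⟩ ⊎ θ x ≡ θ y) →
                       ∀ i → θ z ≡ θ^ i x → z ∈⟨ x ⟩ ⊎ θ^ i x ≡ θ^ i y
    idempotent-above nfx h zero    e = contradiction (sym e) (≢-θ^-suc nfx 0 _)
    idempotent-above {x} {y} nfx h (suc i) e with h (trans e (θ^-suc i x))
    ... | inj₁ z∈x = inj₁ z∈x
    ... | inj₂ x≡y = inj₂ (trans (θ^-suc i x) (trans x≡y (sym (θ^-suc i y))))

    -- The orbits are `x`, `θ x` and `y`, `θ y`. Non-fixed points have no preimages, so only edges
    -- into `θ x` and `θ y` need attention.
    idempotent-swappable : ∀ {x y} → NonFixed x → NonFixed y →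
      (∀ z → θ z ≡ θ x → z ∈⟨ x ⟩ ⊎ θ x ≡ θ y) →
      (∀ z → θ z ≡ θ y → z ∈⟨ y ⟩ ⊎ θ y ≡ θ x) → Swappable x y
    idempotent-swappable nfx nfy hx hy = record
      { forth   = idempotent-forth nfx
      ; back    = idempotent-forth nfy
      ; cross   = idempotent-cross nfx nfy
      ; above-x = λ z i e → Sum.map₁ inj₁ (idempotent-above nfx (hx z) i e)
      ; above-y = λ z i e → Sum.map inj₂ sym (idempotent-above nfy (hy z) i e)
      }

    ∉-idempotent : ∀ {x z} → z ≢ x → z ≢ θ x → ¬ z ∈⟨ x ⟩
    ∉-idempotent z≢x z≢θx (zero  , e) = z≢x e
    ∉-idempotent z≢x z≢θx (suc m , e) = z≢θx (trans e (θ^-suc m _))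

  module _ (idem : ∀ x → Fixed (θ x))
           (tail-unique : ∀ x y → NonFixed x → NonFixed y → θ x ≡ θ y → x ≡ y) where

    tails-swappable : ∀ {x y} → NonFixed x → NonFixed y → Swappable x y
    tails-swappable nfx nfy = idempotent-swappable idem nfx nfy
      (λ z e → inj₁ (tail-∈ nfx e)) (λ z e → inj₁ (tail-∈ nfy e))
      where
      tail-∈ : ∀ {x z} → NonFixed x → θ z ≡ θ x → z ∈⟨ x ⟩
      tail-∈ {x} {z} nfx e with em {Fixed z}
      ... | yes fz = 1 , trans (sym fz) e
      ... | no nfz = 0 , tail-unique z x nfz nfx e

    tails-extension : (∀ x → Fixed x → ∃[ y ] NonFixed y × θ y ≡ x) →
      ∀ {n} (p : Vector Carrier n) x y → x ≢ y → x ∷ p ≃ y ∷ p → OnePointExtension p x y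
    tails-extension tail-exists p x y x≢y s with em {Fixed x}
    ... | no nfx = automorphism , swap-x 0 , λ i → swap-other
          (∉-idempotent idem (≢-entry x≢y s i ∘ sym)
            -- An entry equal to `θ x` is also `θ y`, and a fixed point has only one tail.
            (λ e → x≢y (tail-unique x y nfx nfy (θx≡entry⇒θx≡θy x≢y s i (sym e)))))
          (∉-idempotent idem (≢-entry (x≢y ∘ sym) s′ i ∘ sym)
            (λ e → x≢y (sym (tail-unique y x nfy nfx (θx≡entry⇒θx≡θy (x≢y ∘ sym) s′ i (sym e))))))
      where
      s′ = ≃-sym s
      nfy : NonFixed y
      nfy = nfx ∘ bwd (edge⇔ s zero zero)
      open Swap (tails-swappable nfx nfy)
    ... | yes fx with tail-exists x fx | tail-exists y (fwd (edge⇔ s zero zero) fx)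
    -- Swapping the tails `x′` and `y′` swaps the fixed points one step further on, hence the
    -- exponent 1.
    ...   | x′ , nfx′ , refl | y′ , nfy′ , refl = automorphism , swap-x 1 , λ i → swap-other
          (∉-idempotent idem (λ e → θ-entry-≢ x≢y s i (cong θ e)) (≢-entry x≢y s i ∘ sym))
          (∉-idempotent idem (λ e → θ-entry-≢ (x≢y ∘ sym) s′ i (cong θ e))
            (≢-entry (x≢y ∘ sym) s′ i ∘ sym))
      where
      s′ = ≃-sym s
      open Swap (tails-swappable nfx′ nfy′)

  constant-extension : (∀ x y → θ x ≡ θ y) →
    ∀ {n} (p : Vector Carrier n) x y → x ≢ y → x ∷ p ≃ y ∷ p → OnePointExtension p x y
  constant-extension const p x y x≢y s =
    automorphism , swap-x 0 , λ i →
      fixes (p i) (≢-entry x≢y s i ∘ sym) (≢-entry (x≢y ∘ sym) (≃-sym s) i ∘ sym)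
    where
    idem : ∀ x → Fixed (θ x)
    idem x = const (θ x) x

    nfx : NonFixed x
    nfx fx = x≢y (trans (sym fx) (trans (const x y) (fwd (edge⇔ s zero zero) fx)))

    nfy : NonFixed y
    nfy = nfx ∘ bwd (edge⇔ s zero zero)

    open Swap (idempotent-swappable idem nfx nfy
      (λ _ _ → inj₂ (const x y)) (λ _ _ → inj₂ (const y x)))

    fixes : ∀ z → z ≢ x → z ≢ y → swap z ≡ z
    fixes z z≢x z≢y with em {Fixed z}
    -- There is only one fixed point, and a homomorphism sends it to itself.
    ... | yes fz = trans (cong swap (sym fz)) (trans (swap-homo z) (trans (const _ _) fz))
    ... | no nfz = swap-other
      (∉-idempotent idem z≢x (λ e → nfz (trans (const _ _) (sym e))))
      (∉-idempotent idem z≢y (λ e → nfz (trans (const _ _) (sym e))))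

  normal⇒homogeneous : Normal → ∀ n → TupleHomogeneous n
  normal⇒homogeneous (all-θ²≡id period) = one-point⇒homogeneous λ p x y x≢y s →
    cyclic-extension (cyclic₂ period) s (cyclic₂-avoids (cyclic₂ period) x≢y s)
      (cyclic₂-avoids (cyclic₂ period) (x≢y ∘ sym) (≃-sym s))
  normal⇒homogeneous (all-θ³≡id period) = one-point⇒homogeneous λ p x y x≢y s →
    cyclic-extension (cyclic₃ period) s (cyclic₃-avoids (cyclic₃ period) x≢y s)
      (cyclic₃-avoids (cyclic₃ period) (x≢y ∘ sym) (≃-sym s))
  normal⇒homogeneous (one-4-cycle period square _ one) = one-point⇒homogeneous λ p x y x≢y s →
    cyclic-extension (cyclic₄ period square) s
      (one-4-cycle-avoids (cyclic₄ period square) one x≢y s)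
      (one-4-cycle-avoids (cyclic₄ period square) one (x≢y ∘ sym) (≃-sym s))
  normal⇒homogeneous (tails idem tail-exists tail-unique) =
    one-point⇒homogeneous (tails-extension idem tail-unique tail-exists)
  normal⇒homogeneous (constant const) = one-point⇒homogeneous (constant-extension const)

-- From homogeneity for pairs to a normal form.

module NormalForm (𝓐 : MonounaryAlgebra a) (em : ExcludedMiddle a) where
  open MonounaryAlgebra 𝓐
  open TupleHomogeneity 𝓐
  open Orbits 𝓐

  by-contradiction : {P : Set a} → ¬ ¬ P → P
  by-contradiction = decidable-stable em

  module _ (hom : TupleHomogeneous 2) where

    move-pair : ∀ {x x′ y y′} → (x ≡ x′ ⇔ y ≡ y′) → (Fixed x ⇔ Fixed y) → (Fixed x′ ⇔ Fixed y′) →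
                (θ x ≡ x′ ⇔ θ y ≡ y′) → (θ x′ ≡ x ⇔ θ y′ ≡ y) →
                Σ[ ψ ∈ 𝓐 ≅ 𝓐 ] to ψ x ≡ y × to ψ x′ ≡ y′
    move-pair {x} {x′} {y} {y′} eq fix fix′ edge edge′ =
      let (ψ , ext) = hom (x ∷ x′ ∷ []) (y ∷ y′ ∷ []) same in ψ , ext zero , ext (suc zero)
      where
      same : x ∷ x′ ∷ [] ≃ y ∷ y′ ∷ []
      same = record
        { eq⇔   = λ { zero zero             → mk⇔ (λ _ → refl) (λ _ → refl)
                    ; zero (suc zero)       → eq
                    ; (suc zero) zero       → mk⇔ (sym ∘ fwd eq ∘ sym) (sym ∘ bwd eq ∘ sym)
                    ; (suc zero) (suc zero) → mk⇔ (λ _ → refl) (λ _ → refl) }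
        ; edge⇔ = λ { zero zero             → fix
                    ; zero (suc zero)       → edge
                    ; (suc zero) zero       → edge′
                    ; (suc zero) (suc zero) → fix′ }
        }

    move : ∀ {x y} → (Fixed x ⇔ Fixed y) → Σ[ ψ ∈ 𝓐 ≅ 𝓐 ] to ψ x ≡ y
    move fix =
      let (ψ , ψx≡y , _) = move-pair (mk⇔ (λ _ → refl) (λ _ → refl)) fix fix fix fix in ψ , ψx≡y

    Independent : Carrier → Carrier → Set a
    Independent x y = x ≢ y × NonFixed x × NonFixed y × θ x ≢ y × θ y ≢ x

    -- All relations that could distinguish the two pairs fail in both.
    move-independent : ∀ {x x′ y y′} → Independent x x′ → Independent y y′ →
                       Σ[ ψ ∈ 𝓐 ≅ 𝓐 ] to ψ x ≡ y × to ψ x′ ≡ y′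
    move-independent (p , q , r , s , t) (p′ , q′ , r′ , s′ , t′) =
      move-pair (neither p p′) (neither q q′) (neither r r′) (neither s s′) (neither t t′)
      where
      neither : {P Q : Set a} → ¬ P → ¬ Q → P ⇔ Q
      neither ¬p ¬q = mk⇔ (λ p → contradiction p ¬p) (λ q → contradiction q ¬q)

    -- Some automorphism carries `x` to `y`, and automorphisms preserve equations between iterates.
    nonFixed-relation : ∀ {x y} → NonFixed x → NonFixed y →
                        ∀ m n → θ^ m x ≡ θ^ n x → θ^ m y ≡ θ^ n y
    nonFixed-relation {x} nfx nfy m n e
      with move (mk⇔ (λ f → contradiction f nfx) (λ f → contradiction f nfy))
    ... | ψ , refl = trans (sym (≅-fold ψ m x)) (trans (cong (to ψ) e) (≅-fold ψ n x))

    idempotent : ∀ {x₀} → NonFixed x₀ → Fixed (θ x₀) → ∀ x → Fixed (θ x)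
    idempotent nfx₀ fθx₀ x with em {Fixed x}
    ... | yes fx = cong θ fx
    ... | no nfx = nonFixed-relation nfx₀ nfx 2 1 fθx₀

    idempotent-case : ∃[ x ] NonFixed x × Fixed (θ x) → Normal
    idempotent-case (x₀ , nfx₀ , fθx₀) with em {∃[ c ] ∃[ d ] Fixed c × Fixed d × c ≢ d}
    ... | no unique = constant λ x y → by-contradiction λ ne →
            unique (θ x , θ y , idem x , idem y , ne)
      where idem = idempotent nfx₀ fθx₀
    ... | yes (c , d , fc , fd , c≢d) = tails idem tail-exists λ x y nfx nfy e →
            by-contradiction (distinct-tails nfx nfy e)
      where
      idem = idempotent nfx₀ fθx₀

      -- All fixed points look alike, and `θ x₀` has the tail `x₀`.
      tail-exists : ∀ x → Fixed x → ∃[ y ] NonFixed y × θ y ≡ x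
      tail-exists x fx with move (mk⇔ (λ _ → fx) (λ _ → fθx₀))
      ... | ψ , ψθx₀≡x = to ψ x₀ ,
        (λ e → nfx₀ (≅-injective ψ (trans (≅-homo ψ x₀) e))) ,
        trans (sym (≅-homo ψ x₀)) ψθx₀≡x

      other-fixed : ∀ x → ∃[ z ] Fixed z × x ≢ z
      other-fixed x with em {x ≡ c}
      ... | yes refl = d , fd , c≢d
      ... | no x≢c   = c , fc , x≢c

      image-≢ : ∀ {x y} → NonFixed y → θ x ≢ y
      image-≢ nfy refl = nfy (idem _)

      -- Let `z` be a tail of another fixed point `w`. The pairs `x`, `y` and `x`, `z` are
      -- independent, but only the first has a common image, so no automorphism can take one to the
      -- other.
      distinct-tails : ∀ {x y} → NonFixed x → NonFixed y → θ x ≡ θ y → ¬ x ≢ y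
      distinct-tails {x} {y} nfx nfy e x≢y with other-fixed (θ x)
      ... | w , fw , θx≢w with tail-exists w fw
      ... | z , nfz , θz≡w with move-independent
              (x≢y , nfx , nfy , image-≢ nfy , image-≢ nfx)
              ((λ { refl → θx≢w θz≡w }) , nfx , nfz , image-≢ nfz , image-≢ nfx)
      ... | ψ , ψx≡x , ψy≡z = θx≢w (begin
        θ x        ≡⟨ cong θ ψx≡x ⟨
        θ (to ψ x) ≡⟨ ≅-homo ψ x ⟨
        to ψ (θ x) ≡⟨ cong (to ψ) e ⟩
        to ψ (θ y) ≡⟨ ≅-homo ψ y ⟩
        θ (to ψ y) ≡⟨ cong θ ψy≡z ⟩
        θ z        ≡⟨ θz≡w ⟩
        w          ∎)
        where open ≡-Reasoning

    all-periodic : ∀ {x₀} → NonFixed x₀ → ∀ n → θ^ n x₀ ≡ x₀ → ∀ x → θ^ n x ≡ x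
    all-periodic nfx₀ n e x with em {Fixed x}
    ... | yes fx = θ^-fixed fx n
    ... | no nfx = nonFixed-relation nfx₀ nfx n 0 e

    one-4-cycle-case : ∀ {x₀} → NonFixed x₀ → (∀ {x} → NonFixed x → NonFixed (θ x)) →
                       θ^ 2 x₀ ≢ x₀ → θ^ 3 x₀ ≢ x₀ → Normal
    one-4-cycle-case {x₀} nfx₀ nfθ ne₂ ne₃ =
      one-4-cycle period (λ x nfx → square nfx) (x₀ , nfx₀)
        λ x y nfx nfy → by-contradiction (other-orbit nfx nfy)
      where
      square : ∀ {x} → NonFixed x → θ^ 2 x ≢ x
      square nfx = ne₂ ∘ nonFixed-relation nfx nfx₀ 2 0

      independent : ∀ {x} → NonFixed x → Independent x (θ^ 2 x)
      independent nfx = square nfx ∘ sym , nfx , nfθ (nfθ nfx) , nfθ nfx ∘ sym ,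
        ne₃ ∘ nonFixed-relation nfx nfx₀ 3 0

      flip : ∀ {x y} → Independent x y → Independent y x
      flip (p , q , r , s , t) = p ∘ sym , r , q , t , s

      -- An automorphism exchanging x and θ² x shows that θ⁴ x = x.
      period : ∀ x → θ^ 4 x ≡ x
      period = all-periodic nfx₀ 4
        (let (ψ , ψx≡θ²x , ψθ²x≡x) =
               move-independent (independent nfx₀) (flip (independent nfx₀)) in
         trans (cong (θ^ 2) (sym ψx≡θ²x)) (trans (sym (≅-fold ψ 2 x₀)) ψθ²x≡x))

      -- A point `y` off the orbit of `x` would be independent of `x`, as `θ² x` is. An automorphism
      -- fixing `x` fixes `θ² x` too, and so cannot send it to `y`.
      other-orbit : ∀ {x y} → NonFixed x → NonFixed y → ¬ ¬ y ∈⟨ x ⟩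
      other-orbit {x} {y} nfx nfy y∉x with move-independent (independent nfx)
          ((λ e → y∉x (0 , sym e)) , nfx , nfy , (λ e → y∉x (1 , sym e)) ,
           -- If `θ y ≡ x`, then period 4 gives `y ≡ θ^ 3 x`.
           (λ e → y∉x (3 , trans (sym (period y)) (cong (θ^ 3) e))))
      ... | ψ , ψx≡x , ψθ²x≡y =
        y∉x (2 , trans (sym ψθ²x≡y) (trans (≅-fold ψ 2 x) (cong (θ^ 2) ψx≡x)))

    homogeneous⇒normal : Normal
    homogeneous⇒normal with em {∃[ x ] NonFixed x}
    -- The identity map is counted as the first family without 2-cycles.
    ... | no none = all-θ²≡id λ x → θ^-fixed (by-contradiction λ nfx → none (x , nfx)) 2
    ... | yes (x₀ , nfx₀) with em {Fixed (θ x₀)}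
    ...   | yes fθx₀ = idempotent-case (x₀ , nfx₀ , fθx₀)
    ...   | no nfθx₀ with em {θ^ 2 x₀ ≡ x₀} | em {θ^ 3 x₀ ≡ x₀}
    ...     | yes e | _     = all-θ²≡id (all-periodic nfx₀ 2 e)
    ...     | no _  | yes e = all-θ³≡id (all-periodic nfx₀ 3 e)
    ...     | no ne₂ | no ne₃ = one-4-cycle-case nfx₀
              (λ nfx e → nfθx₀ (nonFixed-relation nfx nfx₀ 2 1 e)) ne₂ ne₃

-- Excluded middle for arbitrary types also chooses elements of inhabited types, and
-- extensionality makes the choice depend on the class only and not on the element defining it.
module Representatives {A : Set a} (em : ExcludedMiddle a) (ext : Extensionality a 0ℓ)
  (_∼_ : A → A → Set a) (∼-refl : ∀ {x} → x ∼ x) (∼-sym : ∀ {x y} → x ∼ y → y ∼ x)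
  (∼-trans : ∀ {x y z} → x ∼ y → y ∼ z → x ∼ z) where

  -- Boolean values let extensionality make the classes of related elements equal; type-valued
  -- classes would only be equivalent pointwise.
  class : A → A → Bool
  class x y = does (em {x ∼ y})

  class-cong : ∀ {x y} → x ∼ y → class x ≡ class y
  class-cong x∼y = ext λ z → does-⇔ (mk⇔ (∼-trans (∼-sym x∼y)) (∼-trans x∼y)) em em

  choose : (P : A → Bool) → .(∃[ x ] P x ≡ true) → ∃[ x ] P x ≡ true
  choose P p = recompute em p

  inhabited : ∀ x → ∃[ y ] class x y ≡ true
  inhabited x = x , dec-true em ∼-refl

  rep : A → A
  rep x = proj₁ (choose (class x) (inhabited x))

  ∼-rep : ∀ x → x ∼ rep x
  ∼-rep x = does-true em (proj₂ (choose (class x) (inhabited x)))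
    where
    does-true : {P : Set a} (p? : Dec P) → does p? ≡ true → P
    does-true (yes p) _ = p

  rep-cong : ∀ {x y} → x ∼ y → rep x ≡ rep y
  rep-cong {x} {y} x∼y = choose-cong (class-cong x∼y)
    where
    -- With the classes generalised to variables their equality can be matched, and irrelevance
    -- identifies the proofs that they are inhabited.
    choose-cong : ∀ {P Q} .{p : ∃[ x ] P x ≡ true} .{q : ∃[ x ] Q x ≡ true} →
                  P ≡ Q → proj₁ (choose P p) ≡ proj₁ (choose Q q)
    choose-cong refl = refl

-- From normal forms to the listed algebras.

module Classification (𝓐 : MonounaryAlgebra a) (em : ExcludedMiddle a) where
  open MonounaryAlgebra 𝓐
  open Orbits 𝓐

  Classified : Set (lsuc a)
  Classified =
      (Σ[ α ∈ Set a ] Σ[ β ∈ Set a ] 𝓐 ≅ α · 𝓩 1 + β · 𝓩 2)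
    ⊎ (Σ[ α ∈ Set a ] Σ[ β ∈ Set a ] 𝓐 ≅ α · 𝓩 1 + β · 𝓩 3)
    ⊎ (Σ[ α ∈ Set a ] 𝓐 ≅ α · 𝓩 1 + 𝓩 4)
    ⊎ (Σ[ α ∈ Set a ] 𝓐 ≅ α · 𝓐[1⨾ ⊤ ])
    ⊎ (Σ[ α ∈ Set a ] 𝓐 ≅ 𝓐[1⨾ α ])

  FixedPoints : Set a
  FixedPoints = Refinement Carrier Fixed

  fixed : (x : FixedPoints) → Fixed (value x)
  fixed (_ , [ p ]) = recompute em p

  module CyclicDecomposition (ext : Extensionality a 0ℓ) {k : ℕ} (cyclic : Cyclic (suc k)) where
    open CyclicProperties cyclic
    open Representatives em ext (λ x y → y ∈⟨ x ⟩) ∈⟨⟩-refl ∈⟨⟩-sym (λ p q → ∈⟨⟩-trans q p)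

    -- Each non-trivial cycle is counted once, by its chosen representative.
    Cycles : Set a
    Cycles = Refinement Carrier (λ x → NonFixed x × rep x ≡ x)

    nonFixed : (y : Cycles) → NonFixed (value y)
    nonFixed (_ , [ p ]) = recompute em (proj₁ p)

    cycle-unique : (y z : Cycles) → value z ∈⟨ value y ⟩ → y ≡ z
    cycle-unique y z z∈y = value-injective
      (trans (sym (rep-value y)) (trans (rep-cong z∈y) (rep-value z)))
      where
      rep-value : (y : Cycles) → rep (value y) ≡ value y
      rep-value (_ , [ p ]) = recompute em (proj₂ p)

    cycle-of : ∀ x → NonFixed x → Cycles
    cycle-of x nfx = rep x , [ nf , sym (rep-cong (∼-rep x)) ]
      where
      nf : NonFixed (rep x)
      nf f = let (m , e) = ∈⟨⟩-sym (∼-rep x)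
                 x≡rep = trans e (θ^-fixed f m)
             in nfx (trans (cong θ x≡rep) (trans f (sym x≡rep)))

    element : FixedPoints × Fin 1 ⊎ Cycles × Fin (suc k) → Carrier
    element (inj₁ (x , _)) = value x
    element (inj₂ (y , i)) = θ^ (toℕ i) (value y)

    decomposition : 𝓐 ≅ FixedPoints · 𝓩 1 + Cycles · 𝓩 (suc k)
    decomposition = inverse-isomorphism element element-homo element-injective element-surjective
      where
      element-homo : Homomorphic (FixedPoints · 𝓩 1 + Cycles · 𝓩 (suc k)) 𝓐 element
      element-homo (inj₁ (x , _)) = sym (fixed x)
      element-homo (inj₂ (y , i)) = θ^-mod (suc (toℕ i)) (value y)

      element-injective : Injective _≡_ _≡_ element
      element-injective {inj₁ (x , zero)} {inj₁ (x′ , zero)} e =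
        cong (λ x → inj₁ (x , zero)) (value-injective e)
      element-injective {inj₁ (x , _)} {inj₂ (y , i)} e =
        contradiction (subst Fixed e (fixed x)) (NonFixed-θ^ (toℕ i) (nonFixed y))
      element-injective {inj₂ (y , i)} {inj₁ (x , _)} e =
        contradiction (subst Fixed (sym e) (fixed x)) (NonFixed-θ^ (toℕ i) (nonFixed y))
      -- A common point puts `y` and `z` on one cycle, so they are the same representative and only
      -- the positions remain to be compared.
      element-injective {inj₂ (y , i)} {inj₂ (z , j)} e
        with refl ← cycle-unique y z (∈⟨⟩-θ^⁻¹ (toℕ j) (toℕ i , sym e)) =
        cong (λ i → inj₂ (y , i)) (θ^-distinct (nonFixed y) i j e)

      element-surjective : StrictlySurjective _≡_ element
      element-surjective x with em {Fixed x}
      ... | yes fx = inj₁ ((x , [ fx ]) , zero) , refl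
      ... | no nfx = let (i , e) = ∈⟨⟩-mod (∈⟨⟩-sym (∼-rep x)) in
                     inj₂ (cycle-of x nfx , i) , sym e

  one-4-cycle-classified : Extensionality a 0ℓ → Cyclic 4 → ∃[ x ] NonFixed x →
    (∀ x y → NonFixed x → NonFixed y → y ∈⟨ x ⟩) → 𝓐 ≅ FixedPoints · 𝓩 1 + 𝓩 4
  one-4-cycle-classified ext cyclic (x₀ , nfx₀) one =
    ≅-trans {𝓑 = FixedPoints · 𝓩 1 + Cycles · 𝓩 4} decomposition
      (isomorphism
        (bijective (Sum.map₂ proj₂) injective
          (λ { (inj₁ x) → inj₁ x , refl ; (inj₂ i) → inj₂ (cycle-of x₀ nfx₀ , i) , refl }))
        (λ { (inj₁ _) → refl ; (inj₂ _) → refl }))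
    where
    open CyclicDecomposition ext cyclic
    injective : Injective _≡_ _≡_ (Sum.map₂ proj₂)
    injective {inj₁ _}       {inj₁ _}       refl = refl
    injective {inj₂ (y , i)} {inj₂ (z , i)} refl =
      cong (λ y → inj₂ (y , i)) (cycle-unique y z (one _ _ (nonFixed y) (nonFixed z)))

  -- Each component is a fixed point with its single tail, so the fixed points index the components.
  tails-classified : (∀ x → Fixed (θ x)) → (∀ x → Fixed x → ∃[ y ] NonFixed y × θ y ≡ x) →
    (∀ x y → NonFixed x → NonFixed y → θ x ≡ θ y → x ≡ y) → 𝓐 ≅ FixedPoints · 𝓐[1⨾ ⊤ ]
  tails-classified idem tail-exists tail-unique =
    inverse-isomorphism element element-homo element-injective element-surjective
    where
    tail-of : (x : FixedPoints) → ∃[ y ] NonFixed y × θ y ≡ value x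
    tail-of x = tail-exists (value x) (fixed x)

    element : FixedPoints × Maybe ⊤ → Carrier
    element (x , nothing) = value x
    element (x , just _)  = proj₁ (tail-of x)

    element-homo : Homomorphic (FixedPoints · 𝓐[1⨾ ⊤ ]) 𝓐 element
    element-homo (x , nothing) = sym (fixed x)
    element-homo (x , just _)  = sym (proj₂ (proj₂ (tail-of x)))

    element-injective : Injective _≡_ _≡_ element
    element-injective {x , nothing} {y , nothing} e = cong (_, nothing) (value-injective e)
    element-injective {x , nothing} {y , just _}  e =
      contradiction (subst Fixed e (fixed x)) (proj₁ (proj₂ (tail-of y)))
    element-injective {x , just _}  {y , nothing} e =
      contradiction (subst Fixed (sym e) (fixed y)) (proj₁ (proj₂ (tail-of x)))
    element-injective {x , just _}  {y , just _}  e = cong (_, just _) (value-injective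
      (trans (sym (proj₂ (proj₂ (tail-of x)))) (trans (cong θ e) (proj₂ (proj₂ (tail-of y))))))

    element-surjective : StrictlySurjective _≡_ element
    element-surjective x with em {Fixed x}
    ... | yes fx = ((x , [ fx ]) , nothing) , refl
    ... | no nfx = let c = (θ x , [ idem x ])
                       (_ , nfy , θy≡θx) = tail-of c
                   in (c , just _) , tail-unique _ x nfy nfx θy≡θx

  -- Nonemptiness enters here: the given point supplies the fixed point `θ x₀`, and all other points
  -- are counted by the cardinal.
  constant-classified : (∀ x y → θ x ≡ θ y) → (x₀ : Carrier) →
                        𝓐 ≅ 𝓐[1⨾ Refinement Carrier (_≢ θ x₀) ]
  constant-classified const x₀ =
    inverse-isomorphism element element-homo element-injective element-surjective
    where
    element : Maybe (Refinement Carrier (_≢ θ x₀)) → Carrier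
    element nothing  = θ x₀
    element (just x) = value x

    element-homo : Homomorphic 𝓐[1⨾ Refinement Carrier (_≢ θ x₀) ] 𝓐 element
    element-homo _ = const x₀ _

    ≢-value : (x : Refinement Carrier (_≢ θ x₀)) → value x ≢ θ x₀
    ≢-value (_ , [ p ]) = recompute em p

    element-injective : Injective _≡_ _≡_ element
    element-injective {nothing} {nothing} _ = refl
    element-injective {nothing} {just y}  e = contradiction (sym e) (≢-value y)
    element-injective {just x}  {nothing} e = contradiction e (≢-value x)
    element-injective {just x}  {just y}  e = cong just (value-injective e)

    element-surjective : StrictlySurjective _≡_ element
    element-surjective x with em {x ≡ θ x₀}
    ... | yes e = nothing , sym e
    ... | no ne = just (x , [ ne ]) , refl

  normal⇒classified : Extensionality a 0ℓ → Carrier → Normal → Classified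
  normal⇒classified ext x₀ (all-θ²≡id period) =
    inj₁ (_ , _ , CyclicDecomposition.decomposition ext (cyclic₂ period))
  normal⇒classified ext x₀ (all-θ³≡id period) =
    inj₂ (inj₁ (_ , _ , CyclicDecomposition.decomposition ext (cyclic₃ period)))
  normal⇒classified ext x₀ (one-4-cycle period square nf one) =
    inj₂ (inj₂ (inj₁ (_ , one-4-cycle-classified ext (cyclic₄ period square) nf one)))
  normal⇒classified ext x₀ (tails idem tail-exists tail-unique) =
    inj₂ (inj₂ (inj₂ (inj₁ (_ , tails-classified idem tail-exists tail-unique))))
  normal⇒classified ext x₀ (constant const) =
    inj₂ (inj₂ (inj₂ (inj₂ (_ , constant-classified const x₀))))

-- From the listed algebras to normal forms.

module _ {𝓐 𝓑 : MonounaryAlgebra a} (ψ : 𝓐 ≅ 𝓑) where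
  private
    module A = Orbits 𝓐
    module B = Orbits 𝓑

  relation-reflect : ∀ m n {x} → B.θ^ m (to ψ x) ≡ B.θ^ n (to ψ x) → A.θ^ m x ≡ A.θ^ n x
  relation-reflect m n {x} e =
    ≅-injective ψ (trans (≅-fold ψ m x) (trans e (sym (≅-fold ψ n x))))

  relation-preserve : ∀ m n {x} → A.θ^ m x ≡ A.θ^ n x → B.θ^ m (to ψ x) ≡ B.θ^ n (to ψ x)
  relation-preserve m n {x} e =
    trans (sym (≅-fold ψ m x)) (trans (cong (to ψ) e) (≅-fold ψ n x))

  nonFixed-preserve : ∀ {x} → A.NonFixed x → B.NonFixed (to ψ x)
  nonFixed-preserve nf = nf ∘ relation-reflect 1 0

  nonFixed-preimage : ∀ {y} → B.NonFixed y → ∃[ x ] A.NonFixed x × to ψ x ≡ y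
  nonFixed-preimage {y} nf with ≅-surjective ψ y
  ... | x , refl = x , nf ∘ relation-preserve 1 0 , refl

  -- All the conditions are built from equations between iterates of `θ`, which an isomorphism
  -- preserves and reflects.
  normal-≅ : B.Normal → A.Normal
  normal-≅ (B.all-θ²≡id period) = A.all-θ²≡id λ x → relation-reflect 2 0 (period _)
  normal-≅ (B.all-θ³≡id period) = A.all-θ³≡id λ x → relation-reflect 3 0 (period _)
  normal-≅ (B.one-4-cycle period square (_ , nf) one) = A.one-4-cycle
    (λ x → relation-reflect 4 0 (period _))
    (λ x nfx → square _ (nonFixed-preserve nfx) ∘ relation-preserve 2 0)
    (let (x , nfx , _) = nonFixed-preimage nf in x , nfx)
    (λ x y nfx nfy →
      let (m , e) = one (to ψ x) (to ψ y) (nonFixed-preserve nfx) (nonFixed-preserve nfy)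
      in m , ≅-injective ψ (trans e (sym (≅-fold ψ m x))))
  normal-≅ (B.tails idem tail-exists tail-unique) = A.tails
    (λ x → relation-reflect 2 1 (idem _))
    (λ x fx →
      let (_ , nf , e)   = tail-exists (to ψ x) (relation-preserve 1 0 fx)
          (y , nfy , e′) = nonFixed-preimage nf
      in y , nfy , ≅-injective ψ (trans (≅-homo ψ y) (trans (cong (MonounaryAlgebra.θ 𝓑) e′) e)))
    (λ x y nfx nfy e → ≅-injective ψ (tail-unique _ _
      (nonFixed-preserve nfx) (nonFixed-preserve nfy)
      (trans (sym (≅-homo ψ x)) (trans (cong (to ψ) e) (≅-homo ψ y)))))
  normal-≅ (B.constant const) = A.constant λ x y →
    ≅-injective ψ (trans (≅-homo ψ x) (trans (const _ _) (sym (≅-homo ψ y))))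

𝓩₁+𝓩₂-normal : (α β : Set a) → Orbits.Normal (α · 𝓩 1 + β · 𝓩 2)
𝓩₁+𝓩₂-normal α β = Orbits.all-θ²≡id λ
  { (inj₁ (_ , zero))     → refl
  ; (inj₂ (_ , zero))     → refl
  ; (inj₂ (_ , suc zero)) → refl }

𝓩₁+𝓩₃-normal : (α β : Set a) → Orbits.Normal (α · 𝓩 1 + β · 𝓩 3)
𝓩₁+𝓩₃-normal α β = Orbits.all-θ³≡id λ
  { (inj₁ (_ , zero))           → refl
  ; (inj₂ (_ , zero))           → refl
  ; (inj₂ (_ , suc zero))       → refl
  ; (inj₂ (_ , suc (suc zero))) → refl }

𝓩₁+𝓩₄-normal : (α : Set a) → Orbits.Normal (α · 𝓩 1 + 𝓩 4)
𝓩₁+𝓩₄-normal α = Orbits.one-4-cycle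
  (λ { (inj₁ (_ , zero))                 → refl
     ; (inj₂ zero)                       → refl
     ; (inj₂ (suc zero))                 → refl
     ; (inj₂ (suc (suc zero)))           → refl
     ; (inj₂ (suc (suc (suc zero))))     → refl })
  (λ { (inj₁ (_ , zero))             nf → contradiction refl nf
     ; (inj₂ zero)                   _ ()
     ; (inj₂ (suc zero))             _ ()
     ; (inj₂ (suc (suc zero)))       _ ()
     ; (inj₂ (suc (suc (suc zero)))) _ () })
  (inj₂ zero , λ ())
  (λ { (inj₁ (_ , zero)) _                 nf _  → contradiction refl nf
     ; (inj₂ _)          (inj₁ (_ , zero)) _  nf → contradiction refl nf
     ; (inj₂ i)          (inj₂ j)          _  _  →
         let (m , e) = reachable i j in m , trans (cong inj₂ e) (fold-inj₂ m) })
  where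
  open MonounaryAlgebra (𝓩 4) renaming (θ to rotate)

  reachable : ∀ i j → ∃[ m ] j ≡ fold i rotate m
  reachable i j =
    -- Decided by evaluation over all pairs of points; bounding the exponent by 4 keeps the search
    -- finite.
    let (m , e) = from-yes (all? λ i → all? λ j → any? λ m → j Fin.≟ fold i rotate (toℕ {4} m)) i j
    in toℕ m , e

  fold-inj₂ : ∀ m {i} → inj₂ (fold i rotate m) ≡ Orbits.θ^ (α · 𝓩 1 + 𝓩 4) m (inj₂ i)
  fold-inj₂ zero    = refl
  fold-inj₂ (suc m) = cong (MonounaryAlgebra.θ (α · 𝓩 1 + 𝓩 4)) (fold-inj₂ m)

tails-normal : (α : Set a) → Orbits.Normal (α · 𝓐[1⨾ ⊤ ])
tails-normal α = Orbits.tails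
  (λ _ → refl)
  (λ { (i , nothing) _ → (i , just _) , (λ ()) , refl })
  (λ { (i , nothing) _             nf _  _    → contradiction refl nf
     ; (i , just _)  (j , nothing) _  nf _    → contradiction refl nf
     ; (i , just _)  (i , just _)  _  _  refl → refl })

constant-normal : (α : Set a) → Orbits.Normal 𝓐[1⨾ α ]
constant-normal α = Orbits.constant λ _ _ → refl

-- The equivalences.

module _ (𝓐 : MonounaryAlgebra a) (em : ExcludedMiddle a) where
  open Classification 𝓐 em using (Classified)

  classified⇒normal : Classified → Orbits.Normal 𝓐
  classified⇒normal (inj₁ (α , β , ψ))                = normal-≅ ψ (𝓩₁+𝓩₂-normal α β)
  classified⇒normal (inj₂ (inj₁ (α , β , ψ)))         = normal-≅ ψ (𝓩₁+𝓩₃-normal α β)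
  classified⇒normal (inj₂ (inj₂ (inj₁ (α , ψ))))        = normal-≅ ψ (𝓩₁+𝓩₄-normal α)
  classified⇒normal (inj₂ (inj₂ (inj₂ (inj₁ (α , ψ))))) = normal-≅ ψ (tails-normal α)
  classified⇒normal (inj₂ (inj₂ (inj₂ (inj₂ (α , ψ))))) = normal-≅ ψ (constant-normal α)

theorem4p14 : {a : Level} → ExcludedMiddle a → Extensionality a 0ℓ →
    (𝓐 : MonounaryAlgebra a) → MonounaryAlgebra.Carrier 𝓐 →
    (PartiallyHomogeneous 𝓐 ⇔
    (PartiallyNHomogeneous 𝓐 1 × PartiallyNHomogeneous 𝓐 2))
    × (PartiallyHomogeneous 𝓐 ⇔ Ultrahomogeneousᵈ (𝓐 *))
    × (PartiallyHomogeneous 𝓐 ⇔ NUltrahomogeneousᵈ (𝓐 *) 2)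
    × (PartiallyHomogeneous 𝓐 ⇔
    ( (Σ[ α ∈ Set a ] Σ[ β ∈ Set a ] 𝓐 ≅ α · 𝓩 1 + β · 𝓩 2)
    ⊎ (Σ[ α ∈ Set a ] Σ[ β ∈ Set a ] 𝓐 ≅ α · 𝓩 1 + β · 𝓩 3)
    ⊎ (Σ[ α ∈ Set a ] 𝓐 ≅ α · 𝓩 1 + 𝓩 4)
    ⊎ (Σ[ α ∈ Set a ] 𝓐 ≅ α · 𝓐[1⨾ ⊤ ])
    ⊎ (Σ[ α ∈ Set a ] 𝓐 ≅ 𝓐[1⨾ α ])))
    × (Ultrahomogeneousᵈ (𝓐 *) → Ultrahomogeneous 𝓐)
theorem4p14 em ext 𝓐 x₀ =
    mk⇔ (λ h → h 1 1≤1 , h 2 1≤2)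
        (λ (h₁ , h₂) → homogeneous₂⇒partially (partially₁₂⇒homogeneous₂ em h₁ h₂))
  , mk⇔ (λ h n _ → homogeneous⇒ultrahomogeneousᵈ em (normal⇒homogeneous (partially⇒normal h) n))
        (λ h → homogeneous₂⇒partially (ultrahomogeneousᵈ⇒homogeneous em (h 2 1≤2)))
  , mk⇔ (λ h → homogeneous⇒ultrahomogeneousᵈ em (partially⇒homogeneous₂ h))
        (homogeneous₂⇒partially ∘ ultrahomogeneousᵈ⇒homogeneous em)
  , mk⇔ (normal⇒classified ext x₀ ∘ partially⇒normal)
        (normal⇒partially ∘ classified⇒normal 𝓐 em)
  , λ h n 1≤n → homogeneous⇒NUltrahomogeneous em (ultrahomogeneousᵈ⇒homogeneous em (h n 1≤n))
  where
  open TupleHomogeneity 𝓐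
  open Orbits 𝓐 using (Normal)
  open Automorphisms 𝓐 em using (normal⇒homogeneous)
  open NormalForm 𝓐 em using (homogeneous⇒normal)
  open Classification 𝓐 em using (normal⇒classified)

  1≤1 = s≤s z≤n
  1≤2 = s≤s z≤n

  partially⇒homogeneous₂ : PartiallyHomogeneous 𝓐 → TupleHomogeneous 2
  partially⇒homogeneous₂ h = partially₁₂⇒homogeneous₂ em (h 1 1≤1) (h 2 1≤2)

  partially⇒normal : PartiallyHomogeneous 𝓐 → Normal
  partially⇒normal = homogeneous⇒normal ∘ partially⇒homogeneous₂

  normal⇒partially : Normal → PartiallyHomogeneous 𝓐
  normal⇒partially nf n _ = homogeneous⇒partiallyNHomogeneous (normal⇒homogeneous nf n)

  -- Closes the circle: conditions (2), (3) and (4) each give homogeneity for pairs, and the normal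
  -- form raises it to all sizes.
  homogeneous₂⇒partially : TupleHomogeneous 2 → PartiallyHomogeneous 𝓐
  homogeneous₂⇒partially = normal⇒partially ∘ homogeneous⇒normal
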